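{- Let $N\in\mathbb{N}$ be fixed and let $\mathcal{F}=\{c_1,\dots,c_m\}$ be a nonempty collection of $k$-colourings of $K_N$. Set $\mathcal{P}=\mathrm{Forb}(\mathcal{F})$ and suppose $\mathcal{P}_n\ne\emptyset$ for every $n\in\mathbb{N}$. For every $\varepsilon$ with $0<\varepsilon<1$, there exist constants $n_0\in\mathbb{N}$ and $C_0>0$ such that for any $k$-colouring template $t$ for $K_n$ with $n\ge n_0$ and $\mathrm{Ent}(t)>(\pi(\mathcal{P})+\varepsilon)\binom{n}{2}$, there are at least $C_0\varepsilon\binom{n}{N}$ pairs $(A,c_i)$ with $A\subseteq[n]$, $|A|=N$, and $c_i\in\mathcal{F}$ such that $c_i\le t_{|A}$.
   Context: $k\ge2$ is a fixed integer and $[k]=\{1,\dots,k\}$. $K_n$ is the complete graph on vertex set $[n]$. A $k$-colouring of $K_n$ is a function $c:E(K_n)\to[k]$. For $A=\{a_1<\dots<a_m\}\subseteq[n]$ the restriction $c_{|A}$ is the $k$-colouring of $K_m$ given by $c_{|A}(ij)=c(a_ia_j)$. A ($k$-colouring) template for $K_n$ is a function $t$ assigning to each edge $e$ a nonempty set $t(e)\subseteq[k]$; its restriction $t_{|A}$ is the template for $K_m$ with $t_{|A}(ij)=t(a_ia_j)$. $\langle t\rangle$ is the set of realisations of $t$, i.e. $k$-colourings $c$ of $K_n$ with $c(e)\in t(e)$ for all $e$. The entropy is $\mathrm{Ent}(t)=\sum_{e\in E(K_n)}\log_k|t(e)|$. For a $k$-colouring $c$ of $K_N$ and an $N$-set $A$,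 $c\le t_{|A}$ means $c(e)\in t_{|A}(e)$ for every $e\in E(K_N)$. $\mathrm{Forb}(\mathcal{F})=(\mathrm{Forb}(\mathcal{F})_n)_n$, where $\mathrm{Forb}(\mathcal{F})_n$ is the set of $k$-colourings $c$ of $K_n$ with $c_{|A}\notin\mathcal{F}$ for every $N$-set $A\subseteq[n]$. For $\mathcal{P}$ closed under restrictions with all $\mathcal{P}_n$ nonempty, $\mathrm{ex}(n,\mathcal{P})=\max\{\mathrm{Ent}(t): t\text{ a template for }K_n,\ \langle t\rangle\subseteq\mathcal{P}_n\}$ and the entropy density is $\pi(\mathcal{P})=\lim_{n\to\infty}\mathrm{ex}(n,\mathcal{P})/\binom n2$ (the limit exists). -}

module Defs where

open import Data.Empty using (⊥; ⊥-elim)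
open import Data.Fin as Fin using (Fin; zero; suc)
open import Data.Fin.Subset using (Subset; ∣_∣; _∈_; Nonempty; inside; outside)
open import Data.Fin.Subset.Properties using (x∈p⇒∣p-x∣<∣p∣)
open import Data.Integer as ℤ using (+_; -[1+_])
import Data.Integer.Properties as ℤ
open import Data.List using (List; []; _++_; map; foldr; allFin)
open import Data.Nat as ℕ using (ℕ; zero; suc; NonZero; NonTrivial)
open import Data.Nat.Combinatorics using (_C_)
import Data.Nat.Coprimality as Coprime
import Data.Nat.Properties as ℕ
open import Data.Nat.Solver using () renaming (module +-*-Solver to ℕ-Solver)
open import Data.Product using (Σ; ∃; ∃₂; _×_; _,_; proj₁; proj₂)
open import Data.Rational as ℚ using (ℚ; mkℚ; 0ℚ; 1ℚ; ½)
import Data.Rational.Properties as ℚ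
open import Data.Rational.Solver using () renaming (module +-*-Solver to ℚ-Solver)
import Data.Rational.Unnormalised as ℚᵘ
import Data.Rational.Unnormalised.Properties as ℚᵘ
open import Data.Sum using (_⊎_; inj₁; inj₂)
open import Data.Unit using (⊤; tt)
open import Data.Vec using (_∷_)
open import Relation.Binary.Definitions using (tri<; tri≈; tri>)
open import Relation.Binary.PropositionalEquality
  using (_≡_; _≗_; refl; sym; trans; cong; cong₂; subst; subst₂; module ≡-Reasoning)
open import Relation.Nullary using (¬_; yes; no)

p<q⇒0<q-p : ∀ {p q} → p ℚ.< q → 0ℚ ℚ.< q ℚ.- p
p<q⇒0<q-p {p} {q} p<q =
  subst (ℚ._< q ℚ.- p) (ℚ.+-inverseʳ p) (ℚ.+-monoˡ-< (ℚ.- p) p<q)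

p≤q⇒0≤q-p : ∀ {p q} → p ℚ.≤ q → 0ℚ ℚ.≤ q ℚ.- p
p≤q⇒0≤q-p {p} {q} p≤q =
  subst (ℚ._≤ q ℚ.- p) (ℚ.+-inverseʳ p) (ℚ.+-monoˡ-≤ (ℚ.- p) p≤q)

p<p+e : ∀ p {e} → 0ℚ ℚ.< e → p ℚ.< p ℚ.+ e
p<p+e p {e} 0<e = subst (ℚ._< p ℚ.+ e) (ℚ.+-identityʳ p) (ℚ.+-monoʳ-< p 0<e)

p-e<p : ∀ p {e} → 0ℚ ℚ.< e → p ℚ.- e ℚ.< p
p-e<p p {e} 0<e =
  subst (p ℚ.- e ℚ.<_) (ℚ.+-identityʳ p) (ℚ.+-monoʳ-< p (ℚ.neg-antimono-< 0<e))

0<1 : 0ℚ ℚ.< 1ℚ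
0<1 = ℚ.positive⁻¹ 1ℚ

*-pos : ∀ {p q} → 0ℚ ℚ.< p → 0ℚ ℚ.< q → 0ℚ ℚ.< p ℚ.* q
*-pos {p} {q} 0<p 0<q =
  ℚ.positive⁻¹ (p ℚ.* q) {{ℚ.pos*pos⇒pos p {{ℚ.positive 0<p}} q {{ℚ.positive 0<q}}}}

infixl 7 _·_
_·_ : ℕ → ℚ → ℚ
zero  · h = 0ℚ
suc n · h = h ℚ.+ n · h

·≡* : ∀ n h → n · h ≡ n · 1ℚ ℚ.* h
·≡* zero    h = sym (ℚ.*-zeroˡ h)
·≡* (suc n) h = begin
  h ℚ.+ n · h                ≡⟨ cong (h ℚ.+_) (·≡* n h) ⟩
  h ℚ.+ n · 1ℚ ℚ.* h         ≡⟨ cong (ℚ._+ n · 1ℚ ℚ.* h) (sym (ℚ.*-identityˡ h)) ⟩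
  1ℚ ℚ.* h ℚ.+ n · 1ℚ ℚ.* h  ≡⟨ sym (ℚ.*-distribʳ-+ h 1ℚ (n · 1ℚ)) ⟩
  (1ℚ ℚ.+ n · 1ℚ) ℚ.* h      ∎
  where open ≡-Reasoning

toℚᵘ-n·1 : ∀ n → ℚ.toℚᵘ (n · 1ℚ) ℚᵘ.≃ ℚᵘ.mkℚᵘ (+ n) 0
toℚᵘ-n·1 zero    = ℚᵘ.≃-refl
toℚᵘ-n·1 (suc n) = ℚᵘ.≃-trans (ℚ.toℚᵘ-homo-+ 1ℚ (n · 1ℚ))
  (ℚᵘ.≃-trans (ℚᵘ.+-congʳ (ℚ.toℚᵘ 1ℚ) (toℚᵘ-n·1 n))
    (ℚᵘ.*≡* (cong (λ i → (+ 1 ℤ.+ i) ℤ.* + 1) (ℤ.*-identityʳ (+ n)))))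

archimedean₁ : ∀ p → ∃ λ n → p ℚ.≤ n · 1ℚ
archimedean₁ p@(mkℚ (+ m) d _) = m , ℚ.toℚᵘ-cancel-≤
  (ℚᵘ.≤-respʳ-≃ (ℚᵘ.≃-sym (toℚᵘ-n·1 m))
    (ℚᵘ.*≤* (ℤ.*-monoˡ-≤-nonNeg (+ m) (ℤ.+≤+ (ℕ.s≤s ℕ.z≤n)))))
archimedean₁ (mkℚ -[1+ _ ] _ _) = 0 , ℚ.*≤* ℤ.-≤+

divide : ∀ p h → 0ℚ ℚ.< h → ∃ λ k → k ℚ.* h ≡ p
divide p h 0<h = p ℚ.* ℚ.1/ h ,
  trans (ℚ.*-assoc p (ℚ.1/ h) h)
    (trans (cong (p ℚ.*_) (ℚ.*-inverseˡ h)) (ℚ.*-identityʳ p))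
  where
  instance
    h-nonZero : ℚ.NonZero h
    h-nonZero = ℚ.pos⇒nonZero h {{ℚ.positive 0<h}}

archimedean : ∀ p h → 0ℚ ℚ.< h → ∃ λ n → p ℚ.≤ n · h
archimedean p h 0<h with divide p h 0<h
... | k , refl with archimedean₁ k
...   | n , k≤n = n , subst (k ℚ.* h ℚ.≤_) (sym (·≡* n h))
                    (ℚ.*-monoʳ-≤-nonNeg h {{ℚ.nonNegative (ℚ.<⇒≤ 0<h)}} k≤n)

p≤∣p∣ : ∀ p → p ℚ.≤ ℚ.∣ p ∣
p≤∣p∣ p with ℚ.≤-total 0ℚ p
... | inj₁ 0≤p = ℚ.≤-reflexive (sym (ℚ.0≤p⇒∣p∣≡p 0≤p))
... | inj₂ p≤0 = ℚ.≤-trans p≤0 (ℚ.0≤∣p∣ p)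

-p≤∣p∣ : ∀ p → ℚ.- p ℚ.≤ ℚ.∣ p ∣
-p≤∣p∣ p = subst (ℚ.- p ℚ.≤_) (ℚ.∣-p∣≡∣p∣ p) (p≤∣p∣ (ℚ.- p))

∣p∣≤ : ∀ {p r} → p ℚ.≤ r → ℚ.- p ℚ.≤ r → ℚ.∣ p ∣ ℚ.≤ r
∣p∣≤ {p} {r} p≤r -p≤r with ℚ.∣p∣≡p∨∣p∣≡-p p
... | inj₁ eq = subst (ℚ._≤ r) (sym eq) p≤r
... | inj₂ eq = subst (ℚ._≤ r) (sym eq) -p≤r

∣p*q∣≤ : ∀ {p q r s} → ℚ.∣ p ∣ ℚ.≤ r → ℚ.∣ q ∣ ℚ.≤ s → ℚ.∣ p ℚ.* q ∣ ℚ.≤ r ℚ.* s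
∣p*q∣≤ {p} {q} {r} {s} ∣p∣≤r ∣q∣≤s = begin
  ℚ.∣ p ℚ.* q ∣          ≡⟨ ℚ.∣p*q∣≡∣p∣*∣q∣ p q ⟩
  ℚ.∣ p ∣ ℚ.* ℚ.∣ q ∣    ≤⟨ ℚ.*-monoʳ-≤-nonNeg ℚ.∣ q ∣ {{ℚ.∣-∣-nonNeg q}} ∣p∣≤r ⟩
  r ℚ.* ℚ.∣ q ∣          ≤⟨ ℚ.*-monoˡ-≤-nonNeg r {{ℚ.nonNegative (ℚ.≤-trans (ℚ.0≤∣p∣ p) ∣p∣≤r)}} ∣q∣≤s ⟩
  r ℚ.* s                ∎
  where open ℚ.≤-Reasoning

module _ where
  open ℚ-Solver

  p+[q-p] : ∀ p q → p ℚ.+ (q ℚ.- p) ≡ q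
  p+[q-p] = solve 2 (λ p q → p :+ (q :- p) := q) refl

  p--[q-p] : ∀ p q → p ℚ.- (ℚ.- (q ℚ.- p)) ≡ q
  p--[q-p] = solve 2 (λ p q → p :- (:- (q :- p)) := q) refl

  p+e-p : ∀ p e → p ℚ.+ e ℚ.- p ≡ e
  p+e-p = solve 2 (λ p e → p :+ e :- p := e) refl

  b+[p-a-b] : ∀ a b p → b ℚ.+ (p ℚ.- a ℚ.- b) ≡ p ℚ.- a
  b+[p-a-b] = solve 3 (λ a b p → b :+ (p :- a :- b) := p :- a) refl

  a+[q-p]+[p-a-b] : ∀ a b p q → a ℚ.+ (q ℚ.- p) ℚ.+ (p ℚ.- a ℚ.- b) ≡ q ℚ.- b
  a+[q-p]+[p-a-b] = solve 4 (λ a b p q → a :+ (q :- p) :+ (p :- a :- b) := q :- b) refl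

  uv-ac : ∀ u v a c → u ℚ.* v ℚ.- a ℚ.* c ≡ (v ℚ.- c) ℚ.* u ℚ.+ (u ℚ.- a) ℚ.* c
  uv-ac = solve 4 (λ u v a c → u :* v :- a :* c := (v :- c) :* u :+ (u :- a) :* c) refl

  p+e+e-e : ∀ p e → p ℚ.+ e ℚ.+ e ℚ.- e ≡ p ℚ.+ e
  p+e+e-e = solve 2 (λ p e → p :+ e :+ e :- e := p :+ e) refl

  regroup : ∀ p e → p ℚ.+ e ℚ.+ e ℚ.+ e ℚ.+ e ≡ p ℚ.+ ((e ℚ.+ e) ℚ.+ (e ℚ.+ e))
  regroup = solve 2 (λ p e → p :+ e :+ e :+ e :+ e := p :+ ((e :+ e) :+ (e :+ e))) refl

halves : ∀ p → p ℚ.* ½ ℚ.+ p ℚ.* ½ ≡ p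
halves p = trans (sym (ℚ.*-distribˡ-+ p ½ ½)) (ℚ.*-identityʳ p)

quarters : ∀ p e → let h = e ℚ.* ½ ℚ.* ½ in p ℚ.+ h ℚ.+ h ℚ.+ h ℚ.+ h ≡ p ℚ.+ e
quarters p e = trans (regroup p (e ℚ.* ½ ℚ.* ½))
  (cong (p ℚ.+_) (trans (cong₂ ℚ._+_ (halves (e ℚ.* ½)) (halves (e ℚ.* ½))) (halves e)))

third : ℚ
third = + 1 ℚ./ 3

thirds : ∀ p → p ℚ.* third ℚ.+ p ℚ.* third ℚ.+ p ℚ.* third ≡ p
thirds p = trans (cong (ℚ._+ p ℚ.* third) (sym (ℚ.*-distribˡ-+ p third third)))
  (trans (sym (ℚ.*-distribˡ-+ p (third ℚ.+ third) third)) (ℚ.*-identityʳ p))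

∣q-p∣≤ : ∀ {p q e} → p ℚ.≤ q → q ℚ.≤ p ℚ.+ e → ℚ.∣ q ℚ.- p ∣ ℚ.≤ e
∣q-p∣≤ {p} {q} {e} p≤q q≤p+e = subst (ℚ._≤ e) (sym (ℚ.0≤p⇒∣p∣≡p (p≤q⇒0≤q-p p≤q)))
  (subst (q ℚ.- p ℚ.≤_) (p+e-p p e)
    (ℚ.+-monoˡ-≤ (ℚ.- p) q≤p+e))

-- Two-sided Dedekind reals: L and U are the rationals strictly below and above.
record ℝ : Set₁ where
  field
    L U        : ℚ → Set
    inhabitedˡ : ∃ L
    inhabitedᵘ : ∃ U
    closedˡ    : ∀ {p q} → p ℚ.< q → L q → L p
    closedᵘ    : ∀ {p q} → p ℚ.< q → U p → U q
    roundedˡ   : ∀ {p} → L p → ∃ λ q → p ℚ.< q × L q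
    roundedᵘ   : ∀ {q} → U q → ∃ λ p → p ℚ.< q × U p
    disjoint   : ∀ {q} → L q → U q → ⊥
    located    : ∀ {p q} → p ℚ.< q → L p ⊎ U q

open ℝ

infix 4 _<ℝ_ _≤ℝ_ _≃ℝ_

_<ℝ_ : ℝ → ℝ → Set
x <ℝ y = ∃ λ q → U x q × L y q

_≤ℝ_ : ℝ → ℝ → Set
x ≤ℝ y = ∀ q → L x q → L y q

_≃ℝ_ : ℝ → ℝ → Set
x ≃ℝ y = x ≤ℝ y × y ≤ℝ x

fromℚ : ℚ → ℝ
fromℚ p = record
  { L = ℚ._< p
  ; U = p ℚ.<_
  ; inhabitedˡ = p ℚ.- 1ℚ , p-e<p p 0<1
  ; inhabitedᵘ = p ℚ.+ 1ℚ , p<p+e p 0<1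
  ; closedˡ  = ℚ.<-trans
  ; closedᵘ  = λ q<r p<q → ℚ.<-trans p<q q<r
  ; roundedˡ = ℚ.<-dense
  ; roundedᵘ = λ p<q → let r , p<r , r<q = ℚ.<-dense p<q in r , r<q , p<r
  ; disjoint = ℚ.<-asym
  ; located  = loc
  }
  where
  loc : ∀ {q r} → q ℚ.< r → q ℚ.< p ⊎ p ℚ.< r
  loc {q} {r} q<r with q ℚ.<? p
  ... | yes q<p = inj₁ q<p
  ... | no  q≮p = inj₂ (ℚ.≤-<-trans (ℚ.≮⇒≥ q≮p) q<r)

fromℕ : ℕ → ℝ
fromℕ n = fromℚ (+ n ℚ./ 1)

0ℝ 1ℝ : ℝ
0ℝ = fromℚ 0ℚ
1ℝ = fromℚ 1ℚ

record Bracket (x : ℝ) : Set where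
  constructor bracket
  field
    {lo hi} : ℚ
    lo∈L    : L x lo
    hi∈U    : U x hi

open Bracket

infix 4 _∈ᴮ_
_∈ᴮ_ : ∀ {x} → ℚ → Bracket x → Set
p ∈ᴮ I = lo I ℚ.≤ p × p ℚ.≤ hi I

L<U : ∀ x {p q} → L x p → U x q → p ℚ.< q
L<U x {p} {q} Lp Uq with ℚ.<-cmp p q
... | tri< p<q _ _   = p<q
... | tri≈ _ refl _  = ⊥-elim (disjoint x Lp Uq)
... | tri> _ _ q<p   = ⊥-elim (disjoint x (closedˡ x q<p Lp) Uq)

L-⊔ : ∀ x {p q} → L x p → L x q → L x (p ℚ.⊔ q)
L-⊔ x {p} {q} Lp Lq with ℚ.≤-total p q
... | inj₁ p≤q = subst (L x) (sym (ℚ.p≤q⇒p⊔q≡q p≤q)) Lq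
... | inj₂ q≤p = subst (L x) (sym (ℚ.p≥q⇒p⊔q≡p q≤p)) Lp

U-⊓ : ∀ x {p q} → U x p → U x q → U x (p ℚ.⊓ q)
U-⊓ x {p} {q} Up Uq with ℚ.≤-total p q
... | inj₁ p≤q = subst (U x) (sym (ℚ.p≤q⇒p⊓q≡p p≤q)) Up
... | inj₂ q≤p = subst (U x) (sym (ℚ.p≥q⇒p⊓q≡q q≤p)) Uq

meet : ∀ {x} (I J : Bracket x) → ∃ λ p → p ∈ᴮ I × p ∈ᴮ J
meet {x} I J = lo I ℚ.⊔ lo J ,
  (ℚ.p≤p⊔q (lo I) (lo J) , ℚ.<⇒≤ (L<U x m∈L (hi∈U I))) ,
  (ℚ.p≤q⊔p (lo I) (lo J) , ℚ.<⇒≤ (L<U x m∈L (hi∈U J)))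
  where
  m∈L = L-⊔ x (lo∈L I) (lo∈L J)

some : ∀ x → Bracket x
some x = bracket (proj₂ (inhabitedˡ x)) (proj₂ (inhabitedᵘ x))

walk : ∀ x h → 0ℚ ℚ.< h → ∀ n {a} → L x a → U x (a ℚ.+ n · h) →
       ∃ λ a′ → L x a′ × U x (a′ ℚ.+ (h ℚ.+ h))
walk x h 0<h zero {a} La Ub = ⊥-elim (disjoint x La (subst (U x) (ℚ.+-identityʳ a) Ub))
walk x h 0<h (suc n) {a} La Ub
  with located x {a ℚ.+ h} {a ℚ.+ (h ℚ.+ h)} (ℚ.+-monoʳ-< a (p<p+e h 0<h))
... | inj₁ L′ = walk x h 0<h n L′ (subst (U x) (sym (ℚ.+-assoc a h (n · h))) Ub)
... | inj₂ U′ = a , La , U′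

third-pos : ∀ {e} → 0ℚ ℚ.< e → ∃ λ h → 0ℚ ℚ.< h × h ℚ.+ h ℚ.< e
third-pos {e} 0<e = h , 0<h , subst (h ℚ.+ h ℚ.<_) (thirds e) (p<p+e (h ℚ.+ h) 0<h)
  where
  h = e ℚ.* third
  0<h : 0ℚ ℚ.< h
  0<h = *-pos {e} {third} 0<e (ℚ.positive⁻¹ third)

U-end : ∀ x {l u e} → U x u → u ℚ.- l ℚ.≤ e → U x (l ℚ.+ e)
U-end x {l} {u} {e} Uu w≤ = closedᵘ x {p} {l ℚ.+ e} p<l+e Up
  where
  p = proj₁ (roundedᵘ x Uu)
  Up = proj₂ (proj₂ (roundedᵘ x Uu))
  p<l+e : p ℚ.< l ℚ.+ e
  p<l+e = ℚ.<-≤-trans {p} {u} {l ℚ.+ e} (proj₁ (proj₂ (roundedᵘ x Uu)))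
    (subst (ℚ._≤ l ℚ.+ e) (p+[q-p] l u) (ℚ.+-monoʳ-≤ l {u ℚ.- l} {e} w≤))

refine : ∀ {x} (I : Bracket x) e → 0ℚ ℚ.< e →
         Σ (Bracket x) λ J → lo I ℚ.≤ lo J × hi J ℚ.≤ hi I × hi J ℚ.< lo J ℚ.+ e
refine {x} I e 0<e = step₁ (third-pos 0<e)
  where
  Goal : Set
  Goal = Σ (Bracket x) λ J → lo I ℚ.≤ lo J × hi J ℚ.≤ hi I × hi J ℚ.< lo J ℚ.+ e

  step₃ : ∀ {h} → h ℚ.+ h ℚ.< e → (∃ λ a → L x a × U x (a ℚ.+ (h ℚ.+ h))) → Goal
  step₃ {h} 2h<e (a , La , Ub) =
    bracket {lo = l} {u} (L-⊔ x (lo∈L I) La) (U-⊓ x (hi∈U I) Ub) ,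
    ℚ.p≤p⊔q (lo I) a , ℚ.p⊓q≤p (hi I) b , u<l+e
    where
    b = a ℚ.+ (h ℚ.+ h)
    l = lo I ℚ.⊔ a
    u = hi I ℚ.⊓ b
    u<l+e : u ℚ.< l ℚ.+ e
    u<l+e = ℚ.≤-<-trans {u} {b} {l ℚ.+ e} (ℚ.p⊓q≤q (hi I) b)
      (ℚ.<-≤-trans {b} {a ℚ.+ e} {l ℚ.+ e}
        (ℚ.+-monoʳ-< a {h ℚ.+ h} {e} 2h<e)
        (ℚ.+-monoˡ-≤ e {a} {l} (ℚ.p≤q⊔p (lo I) a)))

  step₂ : ∀ {h} → 0ℚ ℚ.< h → h ℚ.+ h ℚ.< e → (∃ λ n → hi I ℚ.- lo I ℚ.≤ n · h) → Goal
  step₂ {h} 0<h 2h<e (n , w≤) =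
    step₃ {h} 2h<e (walk x h 0<h n (lo∈L I) (U-end x {lo I} {hi I} {n · h} (hi∈U I) w≤))

  step₁ : (∃ λ h → 0ℚ ℚ.< h × h ℚ.+ h ℚ.< e) → Goal
  step₁ (h , 0<h , 2h<e) = step₂ {h} 0<h 2h<e (archimedean (hi I ℚ.- lo I) h 0<h)

infixl 6 _+ℝ_
_+ℝ_ : ℝ → ℝ → ℝ
x +ℝ y = record
  { L = λ q → ∃₂ λ a b → L x a × L y b × q ℚ.< a ℚ.+ b
  ; U = λ q → ∃₂ λ a b → U x a × U y b × a ℚ.+ b ℚ.< q
  ; inhabitedˡ = let a , La = inhabitedˡ x ; b , Lb = inhabitedˡ y in
      a ℚ.+ b ℚ.- 1ℚ , a , b , La , Lb , p-e<p (a ℚ.+ b) {1ℚ} 0<1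
  ; inhabitedᵘ = let a , Ua = inhabitedᵘ x ; b , Ub = inhabitedᵘ y in
      a ℚ.+ b ℚ.+ 1ℚ , a , b , Ua , Ub , p<p+e (a ℚ.+ b) {1ℚ} 0<1
  ; closedˡ  = λ { {p} {q} p<q (a , b , La , Lb , q<) →
      a , b , La , Lb , ℚ.<-trans {p} {q} {a ℚ.+ b} p<q q< }
  ; closedᵘ  = λ { {p} {q} p<q (a , b , Ua , Ub , <p) →
      a , b , Ua , Ub , ℚ.<-trans {a ℚ.+ b} {p} {q} <p p<q }
  ; roundedˡ = λ { {q} (a , b , La , Lb , q<) →
      let r , q<r , r< = ℚ.<-dense {q} {a ℚ.+ b} q< in r , q<r , a , b , La , Lb , r< }
  ; roundedᵘ = λ { {q} (a , b , Ua , Ub , <q) →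
      let r , <r , r<q = ℚ.<-dense {a ℚ.+ b} {q} <q in r , r<q , a , b , Ua , Ub , <r }
  ; disjoint = λ { {q} (a , b , La , Lb , q<) (a′ , b′ , Ua , Ub , <q) →
      ℚ.<-asym {q} {a′ ℚ.+ b′}
        (ℚ.<-trans {q} {a ℚ.+ b} {a′ ℚ.+ b′} q<
          (ℚ.+-mono-< {a} {a′} {b} {b′} (L<U x La Ua) (L<U y Lb Ub))) <q }
  ; located  = loc
  }
  where
  loc : ∀ {p q} → p ℚ.< q →
        (∃₂ λ a b → L x a × L y b × p ℚ.< a ℚ.+ b) ⊎
        (∃₂ λ a b → U x a × U y b × a ℚ.+ b ℚ.< q)
  loc {p} {q} p<q = bracketed (refine (some x) (q ℚ.- p) (p<q⇒0<q-p p<q))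
    where
    Goal : Set
    Goal = (∃₂ λ a b → L x a × L y b × p ℚ.< a ℚ.+ b) ⊎
           (∃₂ λ a b → U x a × U y b × a ℚ.+ b ℚ.< q)

    decide : ∀ {a b s s′} → L x a → U x b → p ℚ.- a ℚ.< s → s′ ℚ.< q ℚ.- b →
             L y s ⊎ U y s′ → Goal
    decide {a} {b} {s} {s′} La Ub p-a<s s′<q-b (inj₁ Ls) = inj₁ (a , s , La , Ls ,
      subst (ℚ._< a ℚ.+ s) (p+[q-p] a p) (ℚ.+-monoʳ-< a {p ℚ.- a} {s} p-a<s))
    decide {a} {b} {s} {s′} La Ub p-a<s s′<q-b (inj₂ Us) = inj₂ (b , s′ , Ub , Us ,
      subst (b ℚ.+ s′ ℚ.<_) (p+[q-p] b q) (ℚ.+-monoʳ-< b {s′} {q ℚ.- b} s′<q-b))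

    split : ∀ {a b} → L x a → U x b → (∃ λ s → p ℚ.- a ℚ.< s × s ℚ.< q ℚ.- b) → Goal
    split {a} {b} La Ub (s , p-a<s , s<q-b) =
      let s′ , s<s′ , s′<q-b = ℚ.<-dense {s} {q ℚ.- b} s<q-b
      in decide {a} {b} {s} {s′} La Ub p-a<s s′<q-b (located y {s} {s′} s<s′)

    gap : ∀ {a b} → b ℚ.< a ℚ.+ (q ℚ.- p) → p ℚ.- a ℚ.< q ℚ.- b
    gap {a} {b} b<a+e = subst₂ ℚ._<_ (b+[p-a-b] a b p) (a+[q-p]+[p-a-b] a b p q)
      (ℚ.+-monoˡ-< (p ℚ.- a ℚ.- b) {b} {a ℚ.+ (q ℚ.- p)} b<a+e)

    bracketed : (Σ (Bracket x) λ J → lo (some x) ℚ.≤ lo J × hi J ℚ.≤ hi (some x) ×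
                 hi J ℚ.< lo J ℚ.+ (q ℚ.- p)) → Goal
    bracketed (bracket {a} {b} La Ub , _ , _ , b<a+e) =
      split {a} {b} La Ub (ℚ.<-dense {p ℚ.- a} {q ℚ.- b} (gap {a} {b} b<a+e))

∥_∥ : ∀ {x} → Bracket x → ℚ
∥ I ∥ = ℚ.∣ lo I ∣ ℚ.+ ℚ.∣ hi I ∣

0≤∥_∥ : ∀ {x} (I : Bracket x) → 0ℚ ℚ.≤ ∥ I ∥
0≤∥ I ∥ = ℚ.+-mono-≤ {0ℚ} {ℚ.∣ lo I ∣} {0ℚ} {ℚ.∣ hi I ∣} (ℚ.0≤∣p∣ (lo I)) (ℚ.0≤∣p∣ (hi I))

p≤p+q : ∀ p {q} → 0ℚ ℚ.≤ q → p ℚ.≤ p ℚ.+ q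
p≤p+q p {q} 0≤q = subst (ℚ._≤ p ℚ.+ q) (ℚ.+-identityʳ p) (ℚ.+-monoʳ-≤ p {0ℚ} {q} 0≤q)

q≤p+q : ∀ {p} q → 0ℚ ℚ.≤ p → q ℚ.≤ p ℚ.+ q
q≤p+q {p} q 0≤p = subst (ℚ._≤ p ℚ.+ q) (ℚ.+-identityˡ q) (ℚ.+-monoˡ-≤ q {0ℚ} {p} 0≤p)

∣p∣≤∥I∥ : ∀ {x} (I : Bracket x) {p} → p ∈ᴮ I → ℚ.∣ p ∣ ℚ.≤ ∥ I ∥
∣p∣≤∥I∥ I {p} (l≤p , p≤h) = ∣p∣≤ {p} {∥ I ∥}
  (ℚ.≤-trans {p} {hi I} {∥ I ∥} p≤h
    (ℚ.≤-trans {hi I} {ℚ.∣ hi I ∣} {∥ I ∥} (p≤∣p∣ (hi I))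
      (q≤p+q {ℚ.∣ lo I ∣} ℚ.∣ hi I ∣ (ℚ.0≤∣p∣ (lo I)))))
  (ℚ.≤-trans {ℚ.- p} {ℚ.- lo I} {∥ I ∥} (ℚ.neg-antimono-≤ {lo I} {p} l≤p)
    (ℚ.≤-trans {ℚ.- lo I} {ℚ.∣ lo I ∣} {∥ I ∥} (-p≤∣p∣ (lo I))
      (p≤p+q ℚ.∣ lo I ∣ {ℚ.∣ hi I ∣} (ℚ.0≤∣p∣ (hi I)))))

close : ∀ {u v a c δ M η} → δ ℚ.* M ≡ η ℚ.* ½ → ℚ.∣ u ∣ ℚ.≤ M → ℚ.∣ c ∣ ℚ.≤ M →
        ℚ.∣ v ℚ.- c ∣ ℚ.≤ δ → ℚ.∣ u ℚ.- a ∣ ℚ.≤ δ → ℚ.∣ u ℚ.* v ℚ.- a ℚ.* c ∣ ℚ.≤ η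
close {u} {v} {a} {c} {δ} {M} {η} δM ∣u∣≤M ∣c∣≤M ∣v-c∣≤δ ∣u-a∣≤δ =
  subst₂ ℚ._≤_ (cong ℚ.∣_∣ (sym (uv-ac u v a c))) (trans (cong₂ ℚ._+_ δM δM) (halves η))
    (ℚ.≤-trans {ℚ.∣ p ℚ.+ q ∣} {ℚ.∣ p ∣ ℚ.+ ℚ.∣ q ∣} {δ ℚ.* M ℚ.+ δ ℚ.* M}
      (ℚ.∣p+q∣≤∣p∣+∣q∣ p q)
      (ℚ.+-mono-≤ {ℚ.∣ p ∣} {δ ℚ.* M} {ℚ.∣ q ∣} {δ ℚ.* M}
        (∣p*q∣≤ {v ℚ.- c} {u} {δ} {M} ∣v-c∣≤δ ∣u∣≤M)
        (∣p*q∣≤ {u ℚ.- a} {c} {δ} {M} ∣u-a∣≤δ ∣c∣≤M)))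
  where
  p = (v ℚ.- c) ℚ.* u
  q = (u ℚ.- a) ℚ.* c

∣w-m∣≤η : ∀ {w m η} → ℚ.∣ w ℚ.- m ∣ ℚ.≤ η → m ℚ.- η ℚ.≤ w × w ℚ.≤ m ℚ.+ η
∣w-m∣≤η {w} {m} {η} d =
  subst (m ℚ.- η ℚ.≤_) (p--[q-p] m w)
    (ℚ.+-monoʳ-≤ m {ℚ.- η} {ℚ.- (ℚ.- (w ℚ.- m))}
      (ℚ.neg-antimono-≤ {ℚ.- (w ℚ.- m)} {η}
        (ℚ.≤-trans {ℚ.- (w ℚ.- m)} {ℚ.∣ w ℚ.- m ∣} {η} (-p≤∣p∣ (w ℚ.- m)) d))) ,
  subst (ℚ._≤ m ℚ.+ η) (p+[q-p] m w)
    (ℚ.+-monoʳ-≤ m {w ℚ.- m} {η}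
      (ℚ.≤-trans {w ℚ.- m} {ℚ.∣ w ℚ.- m ∣} {η} (p≤∣p∣ (w ℚ.- m)) d))

approx-* : ∀ x y η → 0ℚ ℚ.< η →
           Σ (Bracket x) λ I → Σ (Bracket y) λ J → ∃ λ m →
           ∀ {u v} → u ∈ᴮ I → v ∈ᴮ J → m ℚ.- η ℚ.≤ u ℚ.* v × u ℚ.* v ℚ.≤ m ℚ.+ η
approx-* x y η 0<η = choose M refl (divide (η ℚ.* ½) M 0<M)
  where
  I₀ = some x
  J₀ = some y
  Goal : Set
  Goal = Σ (Bracket x) λ I → Σ (Bracket y) λ J → ∃ λ m →
         ∀ {u v} → u ∈ᴮ I → v ∈ᴮ J → m ℚ.- η ℚ.≤ u ℚ.* v × u ℚ.* v ℚ.≤ m ℚ.+ η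

  M = ∥ I₀ ∥ ℚ.+ ∥ J₀ ∥ ℚ.+ 1ℚ

  0≤sum : 0ℚ ℚ.≤ ∥ I₀ ∥ ℚ.+ ∥ J₀ ∥
  0≤sum = ℚ.+-mono-≤ {0ℚ} {∥ I₀ ∥} {0ℚ} {∥ J₀ ∥} 0≤∥ I₀ ∥ 0≤∥ J₀ ∥

  0<M : 0ℚ ℚ.< M
  0<M = ℚ.≤-<-trans {0ℚ} {∥ I₀ ∥ ℚ.+ ∥ J₀ ∥} {M} 0≤sum (p<p+e (∥ I₀ ∥ ℚ.+ ∥ J₀ ∥) {1ℚ} 0<1)

  ∥I₀∥≤M : ∥ I₀ ∥ ℚ.≤ M
  ∥I₀∥≤M = ℚ.≤-trans {∥ I₀ ∥} {∥ I₀ ∥ ℚ.+ ∥ J₀ ∥} {M}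
    (p≤p+q ∥ I₀ ∥ {∥ J₀ ∥} 0≤∥ J₀ ∥) (p≤p+q (∥ I₀ ∥ ℚ.+ ∥ J₀ ∥) {1ℚ} (ℚ.<⇒≤ 0<1))

  ∥J₀∥≤M : ∥ J₀ ∥ ℚ.≤ M
  ∥J₀∥≤M = ℚ.≤-trans {∥ J₀ ∥} {∥ I₀ ∥ ℚ.+ ∥ J₀ ∥} {M}
    (q≤p+q {∥ I₀ ∥} ∥ J₀ ∥ 0≤∥ I₀ ∥) (p≤p+q (∥ I₀ ∥ ℚ.+ ∥ J₀ ∥) {1ℚ} (ℚ.<⇒≤ 0<1))

  choose : ∀ B → M ≡ B → (∃ λ δ → δ ℚ.* B ≡ η ℚ.* ½) → Goal
  choose B M≡B (δ , δB) = box (refine I₀ δ 0<δ) (refine J₀ δ 0<δ)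
    where
    0<B : 0ℚ ℚ.< B
    0<B = subst (0ℚ ℚ.<_) M≡B 0<M

    0<δ : 0ℚ ℚ.< δ
    0<δ = ℚ.*-cancelʳ-<-nonNeg B {{ℚ.nonNegative (ℚ.<⇒≤ 0<B)}} {0ℚ} {δ}
      (subst₂ ℚ._<_ (sym (ℚ.*-zeroˡ B)) (sym δB) (*-pos {η} {½} 0<η (ℚ.positive⁻¹ ½)))

    box : (Σ (Bracket x) λ I → lo I₀ ℚ.≤ lo I × hi I ℚ.≤ hi I₀ × hi I ℚ.< lo I ℚ.+ δ) →
          (Σ (Bracket y) λ J → lo J₀ ℚ.≤ lo J × hi J ℚ.≤ hi J₀ × hi J ℚ.< lo J ℚ.+ δ) → Goal
    box (I , l≤a , b≤h , b<a+δ) (J , l≤c , d≤h , d<c+δ) = I , J , lo I ℚ.* lo J , bound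
      where
      bound : ∀ {u v} → u ∈ᴮ I → v ∈ᴮ J →
              lo I ℚ.* lo J ℚ.- η ℚ.≤ u ℚ.* v × u ℚ.* v ℚ.≤ lo I ℚ.* lo J ℚ.+ η
      bound {u} {v} (a≤u , u≤b) (c≤v , v≤d) = ∣w-m∣≤η {u ℚ.* v} {lo I ℚ.* lo J} {η}
        (close {u} {v} {lo I} {lo J} {δ} {B} {η} δB
          (subst (ℚ.∣ u ∣ ℚ.≤_) M≡B (ℚ.≤-trans {ℚ.∣ u ∣} {∥ I₀ ∥} {M}
            (∣p∣≤∥I∥ I₀ (ℚ.≤-trans l≤a a≤u , ℚ.≤-trans u≤b b≤h)) ∥I₀∥≤M))
          (subst (ℚ.∣ lo J ∣ ℚ.≤_) M≡B (ℚ.≤-trans {ℚ.∣ lo J ∣} {∥ J₀ ∥} {M}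
            (∣p∣≤∥I∥ J₀ (l≤c , ℚ.≤-trans (ℚ.≤-trans c≤v v≤d) d≤h)) ∥J₀∥≤M))
          (∣q-p∣≤ {lo J} {v} {δ} c≤v (ℚ.≤-trans {v} {hi J} {lo J ℚ.+ δ} v≤d (ℚ.<⇒≤ d<c+δ)))
          (∣q-p∣≤ {lo I} {u} {δ} a≤u (ℚ.≤-trans {u} {hi I} {lo I ℚ.+ δ} u≤b (ℚ.<⇒≤ b<a+δ))))

quarter-pos : ∀ {p q} → p ℚ.< q → ∃ λ η → 0ℚ ℚ.< η × p ℚ.+ η ℚ.+ η ℚ.+ η ℚ.< q
quarter-pos {p} {q} p<q = η , 0<η ,
  subst (p ℚ.+ η ℚ.+ η ℚ.+ η ℚ.<_) (trans (quarters p (q ℚ.- p)) (p+[q-p] p q))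
    (p<p+e (p ℚ.+ η ℚ.+ η ℚ.+ η) {η} 0<η)
  where
  η = (q ℚ.- p) ℚ.* ½ ℚ.* ½
  0<η : 0ℚ ℚ.< η
  0<η = *-pos {(q ℚ.- p) ℚ.* ½} {½}
    (*-pos {q ℚ.- p} {½} (p<q⇒0<q-p p<q) (ℚ.positive⁻¹ ½)) (ℚ.positive⁻¹ ½)

-- A product lies strictly above q when u * v is bounded below by some r > q
-- on a whole box of rational approximations (u , v), and dually.
infixl 7 _*ℝ_
_*ℝ_ : ℝ → ℝ → ℝ
x *ℝ y = record
  { L = Lower
  ; U = Upper
  ; inhabitedˡ = let I , J , m , m± = approx-* x y 1ℚ 0<1 in
      m ℚ.- 1ℚ ℚ.- 1ℚ , m ℚ.- 1ℚ , p-e<p (m ℚ.- 1ℚ) {1ℚ} 0<1 , I , J ,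
      λ u∈ v∈ → proj₁ (m± u∈ v∈)
  ; inhabitedᵘ = let I , J , m , m± = approx-* x y 1ℚ 0<1 in
      m ℚ.+ 1ℚ ℚ.+ 1ℚ , m ℚ.+ 1ℚ , p<p+e (m ℚ.+ 1ℚ) {1ℚ} 0<1 , I , J ,
      λ u∈ v∈ → proj₂ (m± u∈ v∈)
  ; closedˡ  = λ { p<q (r , q<r , box) → r , ℚ.<-trans p<q q<r , box }
  ; closedᵘ  = λ { p<q (r , r<p , box) → r , ℚ.<-trans r<p p<q , box }
  ; roundedˡ = λ { (r , q<r , box) →
      let s , q<s , s<r = ℚ.<-dense q<r in s , q<s , r , s<r , box }
  ; roundedᵘ = λ { (r , r<q , box) →
      let s , r<s , s<q = ℚ.<-dense r<q in s , s<q , r , r<s , box }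
  ; disjoint = dis
  ; located  = loc
  }
  where
  Lower Upper : ℚ → Set
  Lower q = ∃ λ r → q ℚ.< r × Σ (Bracket x) λ I → Σ (Bracket y) λ J →
            ∀ {u v} → u ∈ᴮ I → v ∈ᴮ J → r ℚ.≤ u ℚ.* v
  Upper q = ∃ λ r → r ℚ.< q × Σ (Bracket x) λ I → Σ (Bracket y) λ J →
            ∀ {u v} → u ∈ᴮ I → v ∈ᴮ J → u ℚ.* v ℚ.≤ r

  dis : ∀ {q} → Lower q → Upper q → ⊥
  dis {q} (r , q<r , I , J , r≤) (s , s<q , I′ , J′ , ≤s) =
    let u , u∈I , u∈I′ = meet I I′
        v , v∈J , v∈J′ = meet J J′
    in ℚ.<-asym {q} {r} q<r
         (ℚ.≤-<-trans {r} {s} {q}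
           (ℚ.≤-trans {r} {u ℚ.* v} {s} (r≤ u∈I v∈J) (≤s u∈I′ v∈J′)) s<q)

  loc : ∀ {p q} → p ℚ.< q → Lower p ⊎ Upper q
  loc {p} {q} p<q = step₁ (quarter-pos p<q)
    where
    step₂ : ∀ {η} → 0ℚ ℚ.< η → p ℚ.+ η ℚ.+ η ℚ.+ η ℚ.< q →
            (Σ (Bracket x) λ I → Σ (Bracket y) λ J → ∃ λ m →
              ∀ {u v} → u ∈ᴮ I → v ∈ᴮ J → m ℚ.- η ℚ.≤ u ℚ.* v × u ℚ.* v ℚ.≤ m ℚ.+ η) →
            Lower p ⊎ Upper q
    step₂ {η} 0<η 4η (I , J , m , m±) = decide (ℚ.≤-total (p ℚ.+ η ℚ.+ η) m)
      where
      decide : p ℚ.+ η ℚ.+ η ℚ.≤ m ⊎ m ℚ.≤ p ℚ.+ η ℚ.+ η → Lower p ⊎ Upper q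
      decide (inj₁ h≤m) = inj₁ (p ℚ.+ η , p<p+e p {η} 0<η , I , J , λ {u} {v} u∈ v∈ →
        ℚ.≤-trans {p ℚ.+ η} {m ℚ.- η} {u ℚ.* v}
          (subst (ℚ._≤ m ℚ.- η) (p+e+e-e p η)
            (ℚ.+-monoˡ-≤ (ℚ.- η) {p ℚ.+ η ℚ.+ η} {m} h≤m))
          (proj₁ (m± u∈ v∈)))
      decide (inj₂ m≤h) = inj₂ (p ℚ.+ η ℚ.+ η ℚ.+ η , 4η , I , J , λ {u} {v} u∈ v∈ →
        ℚ.≤-trans {u ℚ.* v} {m ℚ.+ η} {p ℚ.+ η ℚ.+ η ℚ.+ η}
          (proj₂ (m± u∈ v∈))
          (ℚ.+-monoˡ-≤ η {m} {p ℚ.+ η ℚ.+ η} m≤h))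

    step₁ : (∃ λ η → 0ℚ ℚ.< η × p ℚ.+ η ℚ.+ η ℚ.+ η ℚ.< q) → Lower p ⊎ Upper q
    step₁ (η , 0<η , 4η) = step₂ {η} 0<η 4η (approx-* x y η 0<η)

^-cancel-< : ∀ {a b} n → a ℕ.^ n ℕ.< b ℕ.^ n → a ℕ.< b
^-cancel-< n a^n<b^n = ℕ.≰⇒> λ b≤a → ℕ.<⇒≱ a^n<b^n (ℕ.^-monoˡ-≤ n b≤a)

n<k^n : ∀ {k} → 1 ℕ.< k → ∀ n → n ℕ.< k ℕ.^ n
n<k^n 1<k zero = ℕ.z<s
n<k^n {k} 1<k (suc n) = begin-strict
  suc n                     <⟨ ℕ.m<m+n (suc n) ℕ.z<s ⟩
  suc n ℕ.+ suc n           ≡⟨ cong (suc n ℕ.+_) (sym (ℕ.+-identityʳ (suc n))) ⟩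
  2 ℕ.* suc n               ≤⟨ ℕ.*-mono-≤ 1<k (n<k^n 1<k n) ⟩
  k ℕ.* k ℕ.^ n             ∎
  where open ℕ.≤-Reasoning

bernoulli : ∀ a s → a ℕ.^ s ℕ.* (a ℕ.+ s) ℕ.≤ a ℕ.* suc a ℕ.^ s
bernoulli a zero = ℕ.≤-reflexive
  (trans (ℕ.*-identityˡ (a ℕ.+ 0)) (trans (ℕ.+-identityʳ a) (sym (ℕ.*-identityʳ a))))
bernoulli a (suc s) = begin
  a ℕ.* a ℕ.^ s ℕ.* (a ℕ.+ suc s)
    ≤⟨ ℕ.m≤m+n _ (a ℕ.^ s ℕ.* s) ⟩
  a ℕ.* a ℕ.^ s ℕ.* (a ℕ.+ suc s) ℕ.+ a ℕ.^ s ℕ.* s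
    ≡⟨ solve 3 (λ a s x → a :* x :* (a :+ (con 1 :+ s)) :+ x :* s
                            := (con 1 :+ a) :* (x :* (a :+ s))) refl a s (a ℕ.^ s) ⟩
  suc a ℕ.* (a ℕ.^ s ℕ.* (a ℕ.+ s))
    ≤⟨ ℕ.*-monoʳ-≤ (suc a) (bernoulli a s) ⟩
  suc a ℕ.* (a ℕ.* suc a ℕ.^ s)
    ≡⟨ solve 2 (λ a y → (con 1 :+ a) :* (a :* y) := a :* ((con 1 :+ a) :* y)) refl a (suc a ℕ.^ s) ⟩
  a ℕ.* (suc a ℕ.* suc a ℕ.^ s) ∎
  where
  open ℕ.≤-Reasoning
  open ℕ-Solver

power-gap : ∀ k {a b} → 0 ℕ.< a → a ℕ.< b → ∃ λ s → a ℕ.^ suc s ℕ.* k ℕ.< b ℕ.^ suc s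
power-gap k {a@(suc _)} {b} 0<a a<b = a ℕ.* k , ℕ.<-≤-trans
  (ℕ.*-cancelˡ-< a _ _ (ℕ.<-≤-trans step (bernoulli a s)))
  (ℕ.^-monoˡ-≤ s a<b)
  where
  s = suc (a ℕ.* k)
  step : a ℕ.* (a ℕ.^ s ℕ.* k) ℕ.< a ℕ.^ s ℕ.* (a ℕ.+ s)
  step = begin-strict
    a ℕ.* (a ℕ.^ s ℕ.* k)    ≡⟨ solve 3 (λ a x k → a :* (x :* k) := x :* (a :* k)) refl a (a ℕ.^ s) k ⟩
    a ℕ.^ s ℕ.* (a ℕ.* k)    <⟨ ℕ.*-monoʳ-< (a ℕ.^ s) {{ℕ.m^n≢0 a s}} (ℕ.n<1+n (a ℕ.* k)) ⟩
    a ℕ.^ s ℕ.* s            ≤⟨ ℕ.*-monoʳ-≤ (a ℕ.^ s) (ℕ.m≤n+m s a) ⟩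
    a ℕ.^ s ℕ.* (a ℕ.+ s)    ∎
    where
    open ℕ.≤-Reasoning
    open ℕ-Solver

pow-swap : ∀ m i j → (m ℕ.^ i) ℕ.^ j ≡ (m ℕ.^ j) ℕ.^ i
pow-swap m i j = trans (ℕ.^-*-assoc m i j)
  (trans (cong (m ℕ.^_) (ℕ.*-comm i j)) (sym (ℕ.^-*-assoc m j i)))

drop-< : ∀ {p d} .{c : Coprime.Coprime p (suc d)} {i j} .{c′ : Coprime.Coprime i (suc j)} →
          mkℚ (+ p) d c ℚ.< mkℚ (+ i) j c′ → p ℕ.* suc j ℕ.< i ℕ.* suc d
drop-< {p} {d} {_} {i} {j} q<r = ℤ.drop‿+<+
  (subst₂ ℤ._<_ (sym (ℤ.pos-* p (suc j))) (sym (ℤ.pos-* i (suc d))) (ℚ.drop-*<* q<r))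

nonneg≮neg : ∀ {p d} .{c : Coprime.Coprime p (suc d)} {i j} .{c′ : Coprime.Coprime (suc i) (suc j)} →
             ¬ mkℚ (+ p) d c ℚ.< mkℚ -[1+ i ] j c′
nonneg≮neg {p} {d} {_} {i} {j} q<r
  with subst (ℤ._< -[1+ i ] ℤ.* + suc d) (sym (ℤ.pos-* p (suc j))) (ℚ.drop-*<* q<r)
... | ()

<-fraction : ∀ {p d} .{c : Coprime.Coprime p (suc d)} i j → p ℕ.* suc j ℕ.< i ℕ.* suc d → mkℚ (+ p) d c ℚ.< + i ℚ./ suc j
<-fraction {p} {d} i j lt = ℚ.toℚᵘ-cancel-<
  (ℚᵘ.<-respʳ-≃ (ℚᵘ.≃-sym (ℚ.toℚᵘ-fromℚᵘ (ℚᵘ.mkℚᵘ (+ i) j)))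
    (ℚᵘ.*<* (subst₂ ℤ._<_ (ℤ.pos-* p (suc j)) (ℤ.pos-* i (suc d)) (ℤ.+<+ lt))))

fraction-< : ∀ {p d} .{c : Coprime.Coprime p (suc d)} i j → i ℕ.* suc d ℕ.< p ℕ.* suc j → + i ℚ./ suc j ℚ.< mkℚ (+ p) d c
fraction-< {p} {d} i j lt = ℚ.toℚᵘ-cancel-<
  (ℚᵘ.<-respˡ-≃ (ℚᵘ.≃-sym (ℚ.toℚᵘ-fromℚᵘ (ℚᵘ.mkℚᵘ (+ i) j)))
    (ℚᵘ.*<* (subst₂ ℤ._<_ (ℤ.pos-* i (suc d)) (ℤ.pos-* p (suc j)) (ℤ.+<+ lt))))

module _ (k m : ℕ) where

  -- p / d < logₖ m  iff  kᵖ < mᵈ, and dually; as logₖ m ≥ 0, every negative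
  -- rational lies below it.

  log-L log-U : ℚ → Set
  log-L (mkℚ (+ p)    d-1 _) = k ℕ.^ p ℕ.< m ℕ.^ suc d-1
  log-L (mkℚ -[1+ _ ] _   _) = ⊤
  log-U (mkℚ (+ p)    d-1 _) = m ℕ.^ suc d-1 ℕ.< k ℕ.^ p
  log-U (mkℚ -[1+ _ ] _   _) = ⊥

module LogProperties (k m : ℕ) (1<k : 1 ℕ.< k) (0<m : 0 ℕ.< m) where

  instance
    k≢0 : NonZero k
    k≢0 = ℕ.>-nonZero (ℕ.<-trans ℕ.z<s 1<k)

    m≢0 : NonZero m
    m≢0 = ℕ.>-nonZero 0<m

  below : ∀ {p d i j} → p ℕ.* suc j ℕ.≤ i ℕ.* suc d →
          k ℕ.^ i ℕ.< m ℕ.^ suc j → k ℕ.^ p ℕ.< m ℕ.^ suc d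
  below {p} {d} {i} {j} pj≤id lt = ^-cancel-< (suc j) (begin-strict
    (k ℕ.^ p) ℕ.^ suc j      ≡⟨ ℕ.^-*-assoc k p (suc j) ⟩
    k ℕ.^ (p ℕ.* suc j)      ≤⟨ ℕ.^-monoʳ-≤ k pj≤id ⟩
    k ℕ.^ (i ℕ.* suc d)      ≡⟨ sym (ℕ.^-*-assoc k i (suc d)) ⟩
    (k ℕ.^ i) ℕ.^ suc d      <⟨ ℕ.^-monoˡ-< (suc d) lt ⟩
    (m ℕ.^ suc j) ℕ.^ suc d  ≡⟨ pow-swap m (suc j) (suc d) ⟩
    (m ℕ.^ suc d) ℕ.^ suc j  ∎)
    where open ℕ.≤-Reasoning

  above : ∀ {p d i j} → i ℕ.* suc d ℕ.≤ p ℕ.* suc j →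
          m ℕ.^ suc j ℕ.< k ℕ.^ i → m ℕ.^ suc d ℕ.< k ℕ.^ p
  above {p} {d} {i} {j} id≤pj lt = ^-cancel-< (suc j) (begin-strict
    (m ℕ.^ suc d) ℕ.^ suc j  ≡⟨ pow-swap m (suc d) (suc j) ⟩
    (m ℕ.^ suc j) ℕ.^ suc d  <⟨ ℕ.^-monoˡ-< (suc d) lt ⟩
    (k ℕ.^ i) ℕ.^ suc d      ≡⟨ ℕ.^-*-assoc k i (suc d) ⟩
    k ℕ.^ (i ℕ.* suc d)      ≤⟨ ℕ.^-monoʳ-≤ k id≤pj ⟩
    k ℕ.^ (p ℕ.* suc j)      ≡⟨ sym (ℕ.^-*-assoc k p (suc j)) ⟩
    (k ℕ.^ p) ℕ.^ suc j      ∎)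
    where open ℕ.≤-Reasoning

  above′ : ∀ {p d i j} → i ℕ.* suc d ℕ.< p ℕ.* suc j →
           m ℕ.^ suc j ℕ.≤ k ℕ.^ i → m ℕ.^ suc d ℕ.< k ℕ.^ p
  above′ {p} {d} {i} {j} id<pj le = ^-cancel-< (suc j) (begin-strict
    (m ℕ.^ suc d) ℕ.^ suc j  ≡⟨ pow-swap m (suc d) (suc j) ⟩
    (m ℕ.^ suc j) ℕ.^ suc d  ≤⟨ ℕ.^-monoˡ-≤ (suc d) le ⟩
    (k ℕ.^ i) ℕ.^ suc d      ≡⟨ ℕ.^-*-assoc k i (suc d) ⟩
    k ℕ.^ (i ℕ.* suc d)      <⟨ ℕ.^-monoʳ-< k 1<k id<pj ⟩
    k ℕ.^ (p ℕ.* suc j)      ≡⟨ sym (ℕ.^-*-assoc k p (suc j)) ⟩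
    (k ℕ.^ p) ℕ.^ suc j      ∎)
    where open ℕ.≤-Reasoning

  L-≃ : ∀ r {i j} → ℚ.toℚᵘ r ℚᵘ.≃ ℚᵘ.mkℚᵘ (+ i) j → k ℕ.^ i ℕ.< m ℕ.^ suc j → log-L k m r
  L-≃ (mkℚ (+ p) d _) {i} {j} (ℚᵘ.*≡* eq) lt = below {p} {d} {i} {j} (ℕ.≤-reflexive
    (ℤ.+-injective (trans (ℤ.pos-* p (suc j)) (trans eq (sym (ℤ.pos-* i (suc d))))))) lt
  L-≃ (mkℚ -[1+ _ ] _ _) _ _ = tt

  U-≃ : ∀ r {i j} → ℚ.toℚᵘ r ℚᵘ.≃ ℚᵘ.mkℚᵘ (+ i) j → m ℕ.^ suc j ℕ.< k ℕ.^ i → log-U k m r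
  U-≃ (mkℚ (+ p) d _) {i} {j} (ℚᵘ.*≡* eq) lt = above {p} {d} {i} {j} (ℕ.≤-reflexive (sym
    (ℤ.+-injective (trans (ℤ.pos-* p (suc j)) (trans eq (sym (ℤ.pos-* i (suc d)))))))) lt
  U-≃ (mkℚ -[1+ _ ] d _) {i} (ℚᵘ.*≡* eq) lt with trans eq (sym (ℤ.pos-* i (suc d)))
  ... | ()

  L-neg : ∀ r → r ℚ.< 0ℚ → log-L k m r
  L-neg (mkℚ (+ p) d c) r<0 with drop-< {p} {d} {c} {0} {0} r<0
  ... | ()
  L-neg (mkℚ -[1+ _ ] _ _) _ = tt

  L-closed : ∀ p q → p ℚ.< q → log-L k m q → log-L k m p
  L-closed (mkℚ -[1+ _ ] _ _) _ _ _ = tt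
  L-closed (mkℚ (+ p) d c) (mkℚ -[1+ i ] j c′) p<q _ = ⊥-elim (nonneg≮neg {p} {d} {c} {i} {j} {c′} p<q)
  L-closed (mkℚ (+ p) d c) (mkℚ (+ i) j c′) p<q =
    below {p} {d} {i} {j} (ℕ.<⇒≤ (drop-< {p} {d} {c} {i} {j} {c′} p<q))

  U-closed : ∀ p q → p ℚ.< q → log-U k m p → log-U k m q
  U-closed (mkℚ (+ i) j c) (mkℚ -[1+ p ] d c′) p<q _ = nonneg≮neg {i} {j} {c} {p} {d} {c′} p<q
  U-closed (mkℚ (+ i) j c) (mkℚ (+ p) d c′) p<q =
    above {p} {d} {i} {j} (ℕ.<⇒≤ (drop-< {i} {j} {c} {p} {d} {c′} p<q))

  L-rounded : ∀ q → log-L k m q → ∃ λ r → q ℚ.< r × log-L k m r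
  L-rounded q@(mkℚ -[1+ n ] d c) _ =
    let r , q<r , r<0 = ℚ.<-dense {q} {0ℚ} (ℚ.negative⁻¹ q) in r , q<r , L-neg r r<0
  L-rounded q@(mkℚ (+ p) d c) lt with power-gap k (ℕ.m^n>0 k p) lt
  ... | s , gap = + i ℚ./ suc j , <-fraction {p} {d} {c} i j order ,
      L-≃ (+ i ℚ./ suc j) {i} {j} (ℚ.toℚᵘ-fromℚᵘ (ℚᵘ.mkℚᵘ (+ i) j)) lt′
    where
    i = suc (p ℕ.* suc s)
    j = s ℕ.+ d ℕ.* suc s
    order : p ℕ.* suc j ℕ.< i ℕ.* suc d
    order = subst (ℕ._< i ℕ.* suc d)
      (solve 3 (λ p d s → p :* s :* d := p :* (d :* s)) refl p (suc d) (suc s))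
      (ℕ.m<n+m (p ℕ.* suc s ℕ.* suc d) ℕ.z<s)
      where open ℕ-Solver
    lt′ : k ℕ.^ i ℕ.< m ℕ.^ suc j
    lt′ = subst₂ ℕ._<_
      (trans (ℕ.*-comm ((k ℕ.^ p) ℕ.^ suc s) k) (cong (k ℕ.*_) (ℕ.^-*-assoc k p (suc s))))
      (ℕ.^-*-assoc m (suc d) (suc s)) gap

  U-rounded : ∀ q → log-U k m q → ∃ λ r → r ℚ.< q × log-U k m r
  U-rounded (mkℚ (+ zero) d c) lt = ⊥-elim (ℕ.<⇒≱ lt (ℕ.m^n>0 m (suc d)))
  U-rounded (mkℚ (+ p@(suc p′)) d c) lt with power-gap k (ℕ.m^n>0 m (suc d)) lt
  ... | s , gap = + i ℚ./ suc j , fraction-< {p} {d} {c} i j order ,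
      U-≃ (+ i ℚ./ suc j) {i} {j} (ℚ.toℚᵘ-fromℚᵘ (ℚᵘ.mkℚᵘ (+ i) j)) lt′
    where
    i = s ℕ.+ p′ ℕ.* suc s
    j = s ℕ.+ d ℕ.* suc s
    order : i ℕ.* suc d ℕ.< p ℕ.* suc j
    order = subst (i ℕ.* suc d ℕ.<_)
      (solve 3 (λ p d s → p :* s :* d := p :* (d :* s)) refl p (suc d) (suc s))
      (ℕ.m<n+m (i ℕ.* suc d) ℕ.z<s)
      where open ℕ-Solver
    lt′ : m ℕ.^ suc j ℕ.< k ℕ.^ i
    lt′ = ℕ.*-cancelˡ-< k _ _ (subst₂ ℕ._<_
      (trans (ℕ.*-comm ((m ℕ.^ suc d) ℕ.^ suc s) k)
        (cong (k ℕ.*_) (ℕ.^-*-assoc m (suc d) (suc s))))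
      (ℕ.^-*-assoc k p (suc s)) gap)

  LU-disjoint : ∀ q → log-L k m q → log-U k m q → ⊥
  LU-disjoint (mkℚ (+ _) _ _) = ℕ.<-asym

  LU-located : ∀ p q → p ℚ.< q → log-L k m p ⊎ log-U k m q
  LU-located (mkℚ -[1+ _ ] _ _) _ _ = inj₁ tt
  LU-located (mkℚ (+ i) j c) (mkℚ -[1+ p ] d c′) p<q =
    ⊥-elim (nonneg≮neg {i} {j} {c} {p} {d} {c′} p<q)
  LU-located (mkℚ (+ i) j c) (mkℚ (+ p) d c′) p<q with k ℕ.^ i ℕ.<? m ℕ.^ suc j
  ... | yes lt = inj₁ lt
  ... | no ≮   = inj₂ (above′ {p} {d} {i} {j} (drop-< {i} {j} {c} {p} {d} {c′} p<q) (ℕ.≮⇒≥ ≮))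

log : (k m : ℕ) .{{_ : NonTrivial k}} .{{m≢0 : NonZero m}} → ℝ
log k m = record
  { L = log-L k m
  ; U = log-U k m
  ; inhabitedˡ = ℚ.- 1ℚ , tt
  ; inhabitedᵘ = mkℚ (+ m) 0 (Coprime.sym (Coprime.1-coprimeTo m)) ,
      subst (ℕ._< k ℕ.^ m) (sym (ℕ.^-identityʳ m)) (n<k^n 1<k m)
  ; closedˡ  = λ {p} {q} → L-closed p q
  ; closedᵘ  = λ {p} {q} → U-closed p q
  ; roundedˡ = λ {q} → L-rounded q
  ; roundedᵘ = λ {q} → U-rounded q
  ; disjoint = λ {q} → LU-disjoint q
  ; located  = λ {p} {q} → LU-located p q
  }
  where
  1<k = ℕ.nonTrivial⇒n>1 k
  open LogProperties k m 1<k (ℕ.>-nonZero⁻¹ m)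

-- Dividing by zero gives zero; in the limit below this only affects n < 2.
infixl 7 _÷_
_÷_ : ℝ → ℕ → ℝ
x ÷ zero  = 0ℝ
x ÷ suc n = x *ℝ fromℚ (+ 1 ℚ./ suc n)

-- | x n - l | < δ is spelled out as x n < l + δ and l < x n + δ.
_⟶_ : (ℕ → ℝ) → ℝ → Set₁
x ⟶ l = ∀ δ → 0ℝ <ℝ δ → ∃ λ n₀ → ∀ n → n₀ ℕ.≤ n → x n <ℝ l +ℝ δ × l <ℝ x n +ℝ δ

-- The unordered pair {i , j} is stored with its smaller endpoint first.
record Edge (n : ℕ) : Set where
  constructor edge
  field
    src tgt  : Fin n
    .src<tgt : src Fin.< tgt

open Edge public

sucᵉ : ∀ {n} → Edge n → Edge (suc n)
sucᵉ (edge i j i<j) = edge (suc i) (suc j) (ℕ.s<s i<j)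

edges : ∀ n → List (Edge n)
edges zero    = []
edges (suc n) = map (λ j → edge zero (suc j) ℕ.z<s) (allFin n) ++ map sucᵉ (edges n)

-- element A i is the i-th smallest element of A.
element : ∀ {n} (A : Subset n) → Fin ∣ A ∣ → Fin n
element (inside  ∷ A) zero    = zero
element (inside  ∷ A) (suc i) = suc (element A i)
element (outside ∷ A) i       = suc (element A i)

element-mono-< : ∀ {n} (A : Subset n) {i j} → i Fin.< j → element A i Fin.< element A j
element-mono-< (inside  ∷ A) {zero}  {suc j} _   = ℕ.z<s
element-mono-< (inside  ∷ A) {suc i} {suc j} i<j = ℕ.s<s (element-mono-< A (ℕ.s<s⁻¹ i<j))
element-mono-< (outside ∷ A)                 i<j = ℕ.s<s (element-mono-< A i<j)

restrict : ∀ {a} {X : Set a} {n m} (A : Subset n) → ∣ A ∣ ≡ m → (Edge n → X) → (Edge m → X)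
restrict A refl f (edge i j i<j) =
  f (edge (element A i) (element A j) (element-mono-< A i<j))

Colouring : ℕ → ℕ → Set
Colouring k n = Edge n → Fin k

Template : ℕ → ℕ → Set
Template k n = Edge n → ∃ λ (S : Subset k) → Nonempty S

infix 4 _≼_
_≼_ : ∀ {k n} → Colouring k n → Template k n → Set
c ≼ t = ∀ e → c e ∈ proj₁ (t e)

nonempty⇒nonZero : ∀ {k} {S : Subset k} → Nonempty S → NonZero ∣ S ∣
nonempty⇒nonZero (_ , x∈S) = ℕ.>-nonZero (ℕ.≤-<-trans ℕ.z≤n (x∈p⇒∣p-x∣<∣p∣ x∈S))

Ent : ∀ {k n} .{{_ : NonTrivial k}} → Template k n → ℝ
Ent {k} {n} t = foldr _+ℝ_ 0ℝ (map weight (edges n))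
  where
  weight : Edge n → ℝ
  weight e = log k ∣ proj₁ (t e) ∣ {{m≢0 = nonempty⇒nonZero (proj₂ (t e))}}

Property : ℕ → Set₁
Property k = ∀ n → Colouring k n → Set

Forb : ∀ {k N m} → (Fin m → Colouring k N) → Property k
Forb {N = N} F n c = ∀ (A : Subset n) (∣A∣≡N : ∣ A ∣ ≡ N) i → ¬ (restrict A ∣A∣≡N c ≗ F i)

module _ {k} .{{_ : NonTrivial k}} (P : Property k) where

  Admissible : ∀ {n} → Template k n → Set
  Admissible {n} t = ∀ c → c ≼ t → P n c

  record IsEx (n : ℕ) (x : ℝ) : Set where
    field
      attained   : ∃ λ (t : Template k n) → Admissible t × Ent t ≃ℝ x
      upperBound : ∀ (t : Template k n) → Admissible t → Ent t ≤ℝ x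

  -- The sequence ex is determined by IsEx up to _≃ℝ_.
  IsEntropyDensity : ℝ → Set₁
  IsEntropyDensity π = ∃ λ (ex : ℕ → ℝ) →
    (∀ n → IsEx n (ex n)) × (λ n → ex n ÷ (n C 2)) ⟶ π

{-# OPTIONS --safe #-}

-- Supersaturation by averaging. Fix M with ex(M) / (M C 2) < π + ε. The average of
-- Ent(t|B) / (M C 2) over the M-sets B is Ent(t) / (n C 2) > π + ε, while an M-set B
-- containing no copy of a forbidden colouring has Ent(t|B) ≤ ex(M). As Ent(t|B) is bounded,
-- a positive proportion of the M-sets B contains a copy, and each N-set lies in the same
-- number of M-sets. Since ε < 1, a lower bound C₀ on the density of copies also gives C₀ ε.
-- The logarithms are replaced by rational upper approximations with error at most η, so
-- that all averaging takes place in ℚ; it is decidable whether B contains a copy.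

module Submission where

open import Defs
open import Data.Bool using (if_then_else_)
open import Data.Empty using (⊥-elim; ⊥-elim-irr)
open import Data.Fin as Fin using (Fin; zero; suc)
import Data.Fin.Properties as Fin
open import Data.Fin.Subset using (Subset; ∣_∣; ⊥; inside; outside) renaming (_∈_ to _∈ₛ_)
open import Data.Fin.Subset.Properties using (∣⊥∣≡0; ∣p∣≤n; _∈?_)
open import Data.Integer as ℤ using ()
import Data.Integer.Properties as ℤ
open import Data.List using (List; []; _∷_; _++_; map; filter; length; allFin; foldr)
open import Data.List.Membership.Propositional using (_∈_)
open import Data.List.Membership.Propositional.Properties using (∈-map⁺; ∈-map⁻; ∈-++⁺ˡ; ∈-++⁺ʳ)
import Data.List.Properties as List
open import Data.List.Relation.Unary.All as All using (All; []; _∷_)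
import Data.List.Relation.Unary.All.Properties as All
open import Data.List.Relation.Unary.AllPairs using ([]; _∷_)
open import Data.List.Relation.Unary.Any using (here; there)
open import Data.List.Relation.Unary.Unique.Propositional using (Unique)
import Data.List.Relation.Unary.Unique.Propositional.Properties as Unique
open import Data.Nat as ℕ using (ℕ; zero; suc; NonZero; NonTrivial; _≤_; _<_; z≤n; s≤s)
open import Data.Nat.Combinatorics using (_C_; nC1≡n; nCk+nC[k+1]≡[n+1]C[k+1])
import Data.Nat.Properties as ℕ
open import Data.Product using (Σ; ∃; _×_; _,_; proj₁; proj₂)
open import Data.Rational as ℚ using (ℚ; mkℚ; 0ℚ; 1ℚ)
import Data.Rational.Properties as ℚ
open import Data.Rational.Solver using () renaming (module +-*-Solver to ℚ-Solver)
import Data.Rational.Unnormalised as ℚᵘ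
import Data.Rational.Unnormalised.Properties as ℚᵘ
open import Data.Sum using (_⊎_; inj₁; inj₂)
open import Data.Vec using ([]; _∷_)
open import Function using (_∘_; id)
open import Function.Definitions using (Injective)
open import Level using (Level)
open import Relation.Binary.PropositionalEquality
  using (_≡_; _≗_; refl; sym; trans; cong; cong₂; subst; subst₂; module ≡-Reasoning)
open import Relation.Nullary using (¬_; Dec; yes; no; does)
open import Relation.Nullary.Decidable using (map′)
open import Relation.Unary using (Decidable)

open ℝ
open Bracket

private
  variable
    ℓ : Level
    X Y : Set ℓ
    P : X → Set ℓ
    n : ℕ

-- Rationals and binomial coefficients

-- The rational inside `fromℕ`, so that `fromℕ c` is `fromℚ (ι c)` by definition.
ι : ℕ → ℚ
ι n = ℤ.+ n ℚ./ 1

-- `ℚ./` normalises by a gcd and does not compute on `suc`; the successor law of `ι` is taken from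
-- the recursive `_·_`.
ι≡·1 : ∀ n → ι n ≡ n · 1ℚ
ι≡·1 n = ℚ.toℚᵘ-injective
  (ℚᵘ.≃-trans (ℚ.toℚᵘ-fromℚᵘ (ℚᵘ.mkℚᵘ (ℤ.+ n) 0)) (ℚᵘ.≃-sym (toℚᵘ-n·1 n)))

ι-suc : ∀ n → ι (suc n) ≡ 1ℚ ℚ.+ ι n
ι-suc n = trans (ι≡·1 (suc n)) (cong (1ℚ ℚ.+_) (sym (ι≡·1 n)))

ι-+ : ∀ m n → ι (m ℕ.+ n) ≡ ι m ℚ.+ ι n
ι-+ zero    n = sym (ℚ.+-identityˡ (ι n))
ι-+ (suc m) n = begin
  ι (suc (m ℕ.+ n))        ≡⟨ ι-suc (m ℕ.+ n) ⟩
  1ℚ ℚ.+ ι (m ℕ.+ n)       ≡⟨ cong (1ℚ ℚ.+_) (ι-+ m n) ⟩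
  1ℚ ℚ.+ (ι m ℚ.+ ι n)     ≡⟨ sym (ℚ.+-assoc 1ℚ (ι m) (ι n)) ⟩
  1ℚ ℚ.+ ι m ℚ.+ ι n       ≡⟨ cong (ℚ._+ ι n) (sym (ι-suc m)) ⟩
  ι (suc m) ℚ.+ ι n        ∎
  where open ≡-Reasoning

0≤ι : ∀ n → 0ℚ ℚ.≤ ι n
0≤ι zero    = ℚ.≤-refl
0≤ι (suc n) = subst (0ℚ ℚ.≤_) (sym (ι-suc n))
  (ℚ.≤-trans (ℚ.<⇒≤ 0<1) (p≤p+q 1ℚ (0≤ι n)))

1≤ι : ∀ {n} → 0 < n → 1ℚ ℚ.≤ ι n
1≤ι {suc n} _ = subst (1ℚ ℚ.≤_) (sym (ι-suc n)) (p≤p+q 1ℚ (0≤ι n))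

0<ι : ∀ {n} → 0 < n → 0ℚ ℚ.< ι n
0<ι 0<n = ℚ.<-≤-trans 0<1 (1≤ι 0<n)

0<nCk : ∀ {n k} → k ≤ n → 0 < n C k
0<nCk {n}     {zero}  _         = ℕ.z<s
0<nCk {suc n} {suc k} (s≤s k≤n) = subst (0 <_) (nCk+nC[k+1]≡[n+1]C[k+1] n k)
  (ℕ.<-≤-trans (0<nCk k≤n) (ℕ.m≤m+n (n C k) (n C suc k)))

nC2+n≡[n+1]C2 : ∀ n → n ℕ.+ n C 2 ≡ suc n C 2
nC2+n≡[n+1]C2 n = trans (cong (ℕ._+ n C 2) (sym (nC1≡n n))) (nCk+nC[k+1]≡[n+1]C[k+1] n 1)

*-monoˡ : ∀ {p q} r → 0ℚ ℚ.≤ r → p ℚ.≤ q → r ℚ.* p ℚ.≤ r ℚ.* q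
*-monoˡ r 0≤r = ℚ.*-monoˡ-≤-nonNeg r {{ℚ.nonNegative 0≤r}}

*-monoʳ : ∀ {p q} r → 0ℚ ℚ.≤ r → p ℚ.≤ q → p ℚ.* r ℚ.≤ q ℚ.* r
*-monoʳ r 0≤r = ℚ.*-monoʳ-≤-nonNeg r {{ℚ.nonNegative 0≤r}}

*-nonNeg : ∀ {p q} → 0ℚ ℚ.≤ p → 0ℚ ℚ.≤ q → 0ℚ ℚ.≤ p ℚ.* q
*-nonNeg {p} {q} 0≤p 0≤q = subst (ℚ._≤ p ℚ.* q) (ℚ.*-zeroʳ p) (*-monoˡ p 0≤p 0≤q)

-- Finite sums over lists

∑ : List X → (X → ℚ) → ℚ
∑ []       f = 0ℚ
∑ (x ∷ xs) f = f x ℚ.+ ∑ xs f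

∑-cong-∈ : ∀ (xs : List X) {f g} → (∀ {x} → x ∈ xs → f x ≡ g x) → ∑ xs f ≡ ∑ xs g
∑-cong-∈ []       f≡g = refl
∑-cong-∈ (x ∷ xs) f≡g = cong₂ ℚ._+_ (f≡g (here refl)) (∑-cong-∈ xs (f≡g ∘ there))

∑-cong : ∀ (xs : List X) {f g} → f ≗ g → ∑ xs f ≡ ∑ xs g
∑-cong xs f≗g = ∑-cong-∈ xs (λ {x} _ → f≗g x)

∑-++ : ∀ (xs ys : List X) f → ∑ (xs ++ ys) f ≡ ∑ xs f ℚ.+ ∑ ys f
∑-++ []       ys f = sym (ℚ.+-identityˡ (∑ ys f))
∑-++ (x ∷ xs) ys f = trans (cong (f x ℚ.+_) (∑-++ xs ys f)) (sym (ℚ.+-assoc (f x) _ _))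

∑-map : ∀ (h : X → Y) xs f → ∑ (map h xs) f ≡ ∑ xs (f ∘ h)
∑-map h []       f = refl
∑-map h (x ∷ xs) f = cong (f (h x) ℚ.+_) (∑-map h xs f)

∑-map-++-map : ∀ {Z : Set} (h : X → Z) (i : Y → Z) xs ys f →
               ∑ (map h xs ++ map i ys) f ≡ ∑ xs (f ∘ h) ℚ.+ ∑ ys (f ∘ i)
∑-map-++-map h i xs ys f =
  trans (∑-++ (map h xs) (map i ys) f) (cong₂ ℚ._+_ (∑-map h xs f) (∑-map i ys f))

∑-mono : ∀ (xs : List X) {f g} → (∀ {x} → x ∈ xs → f x ℚ.≤ g x) → ∑ xs f ℚ.≤ ∑ xs g
∑-mono []       f≤g = ℚ.≤-refl
∑-mono (x ∷ xs) f≤g = ℚ.+-mono-≤ (f≤g (here refl)) (∑-mono xs (f≤g ∘ there))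

∑-const : ∀ (xs : List X) p → ∑ xs (λ _ → p) ≡ ι (length xs) ℚ.* p
∑-const []       p = sym (ℚ.*-zeroˡ p)
∑-const (x ∷ xs) p = begin
  p ℚ.+ ∑ xs (λ _ → p)               ≡⟨ cong (p ℚ.+_) (∑-const xs p) ⟩
  p ℚ.+ ι (length xs) ℚ.* p          ≡⟨ solve 2 (λ p n → p :+ n :* p := (con 1ℚ :+ n) :* p) refl p (ι (length xs)) ⟩
  (1ℚ ℚ.+ ι (length xs)) ℚ.* p       ≡⟨ cong (ℚ._* p) (sym (ι-suc (length xs))) ⟩
  ι (suc (length xs)) ℚ.* p          ∎
  where
  open ≡-Reasoning
  open ℚ-Solver

∑-+ : ∀ (xs : List X) f g → ∑ xs (λ x → f x ℚ.+ g x) ≡ ∑ xs f ℚ.+ ∑ xs g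
∑-+ []       f g = refl
∑-+ (x ∷ xs) f g = trans (cong (f x ℚ.+ g x ℚ.+_) (∑-+ xs f g))
  (solve 4 (λ a b c d → a :+ b :+ (c :+ d) := a :+ c :+ (b :+ d)) refl (f x) (g x) (∑ xs f) (∑ xs g))
  where open ℚ-Solver

∑-*ˡ : ∀ (xs : List X) p f → ∑ xs (λ x → p ℚ.* f x) ≡ p ℚ.* ∑ xs f
∑-*ˡ []       p f = sym (ℚ.*-zeroʳ p)
∑-*ˡ (x ∷ xs) p f =
  trans (cong (p ℚ.* f x ℚ.+_) (∑-*ˡ xs p f)) (sym (ℚ.*-distribˡ-+ p (f x) (∑ xs f)))

𝟙 : Dec Y → ℚ
𝟙 P? = if does P? then 1ℚ else 0ℚ

0≤𝟙 : ∀ (P? : Dec Y) → 0ℚ ℚ.≤ 𝟙 P?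
0≤𝟙 (yes _) = ℚ.<⇒≤ 0<1
0≤𝟙 (no  _) = ℚ.≤-refl

0≤∑𝟙 : ∀ (P? : Decidable {A = X} P) xs → 0ℚ ℚ.≤ ∑ xs (𝟙 ∘ P?)
0≤∑𝟙 P? []       = ℚ.≤-refl
0≤∑𝟙 P? (x ∷ xs) = ℚ.+-mono-≤ (0≤𝟙 (P? x)) (0≤∑𝟙 P? xs)

-- The case split behind the averaging, applied to the sets inside one M-set: either the bound by
-- ex(M) is available, or the count of copies is large enough to pay for the trivial bound.
none-or-1≤∑𝟙 : ∀ (P? : Decidable {A = X} P) xs →
                All (¬_ ∘ P) xs ⊎ 1ℚ ℚ.≤ ∑ xs (𝟙 ∘ P?)
none-or-1≤∑𝟙 P? []       = inj₁ []
none-or-1≤∑𝟙 P? (x ∷ xs) with P? x | none-or-1≤∑𝟙 P? xs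
... | yes _  | _        = inj₂ (p≤p+q 1ℚ (0≤∑𝟙 P? xs))
... | no ¬Px | inj₁ ¬Ps = inj₁ (¬Px ∷ ¬Ps)
... | no _   | inj₂ 1≤  = inj₂ (subst (1ℚ ℚ.≤_) (sym (ℚ.+-identityˡ (∑ xs (𝟙 ∘ P?)))) 1≤)

∑𝟙≡length-filter : ∀ (P? : Decidable {A = X} P) xs → ∑ xs (𝟙 ∘ P?) ≡ ι (length (filter P? xs))
∑𝟙≡length-filter P? []       = refl
∑𝟙≡length-filter P? (x ∷ xs) with P? x
... | yes _ = trans (cong (1ℚ ℚ.+_) (∑𝟙≡length-filter P? xs)) (sym (ι-suc (length (filter P? xs))))
... | no  _ = trans (ℚ.+-identityˡ (∑ xs (𝟙 ∘ P?))) (∑𝟙≡length-filter P? xs)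

-- Subsets of a given size

subsets : ∀ n → ℕ → List (Subset n)
subsets n       zero    = ⊥ ∷ []
subsets zero    (suc m) = []
subsets (suc n) (suc m) = map (outside ∷_) (subsets n (suc m)) ++ map (inside ∷_) (subsets n m)

∑-subsets-suc : ∀ n m f → ∑ (subsets (suc n) (suc m)) f ≡
                ∑ (subsets n (suc m)) (f ∘ (outside ∷_)) ℚ.+ ∑ (subsets n m) (f ∘ (inside ∷_))
∑-subsets-suc n m f = ∑-map-++-map (outside ∷_) (inside ∷_) (subsets n (suc m)) (subsets n m) f

length-subsets : ∀ n m → length (subsets n m) ≡ n C m
length-subsets n       zero    = refl
length-subsets zero    (suc m) = refl
length-subsets (suc n) (suc m) = begin
  length (map (outside ∷_) (subsets n (suc m)) ++ map (inside ∷_) (subsets n m))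
    ≡⟨ List.length-++ (map (outside ∷_) (subsets n (suc m))) ⟩
  length (map (outside ∷_) (subsets n (suc m))) ℕ.+ length (map (inside ∷_) (subsets n m))
    ≡⟨ cong₂ ℕ._+_ (List.length-map (outside ∷_) (subsets n (suc m))) (List.length-map (inside ∷_) (subsets n m)) ⟩
  length (subsets n (suc m)) ℕ.+ length (subsets n m)
    ≡⟨ cong₂ ℕ._+_ (length-subsets n (suc m)) (length-subsets n m) ⟩
  n C suc m ℕ.+ n C m  ≡⟨ ℕ.+-comm (n C suc m) (n C m) ⟩
  n C m ℕ.+ n C suc m  ≡⟨ nCk+nC[k+1]≡[n+1]C[k+1] n m ⟩
  suc n C suc m        ∎
  where open ≡-Reasoning

subsets-empty : ∀ {n m} → n < m → subsets n m ≡ []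
subsets-empty {zero}  {suc m} _         = refl
subsets-empty {suc n} {suc m} (s≤s n<m) = cong₂ (λ xs ys → map (outside ∷_) xs ++ map (inside ∷_) ys)
  (subsets-empty (ℕ.m<n⇒m<1+n n<m)) (subsets-empty n<m)

subsets-size : ∀ n m → All (λ A → ∣ A ∣ ≡ m) (subsets n m)
subsets-size n       zero    = ∣⊥∣≡0 n ∷ []
subsets-size zero    (suc m) = []
subsets-size (suc n) (suc m) = All.++⁺ (All.map⁺ (subsets-size n (suc m)))
  (All.map⁺ (All.map (cong suc) (subsets-size n m)))

∣A∣≡0⇒A≡⊥ : ∀ (A : Subset n) → ∣ A ∣ ≡ 0 → A ≡ ⊥
∣A∣≡0⇒A≡⊥ []            _     = refl
∣A∣≡0⇒A≡⊥ (outside ∷ A) ∣A∣≡0 = cong (outside ∷_) (∣A∣≡0⇒A≡⊥ A ∣A∣≡0)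

∈-subsets : ∀ (A : Subset n) {m} → ∣ A ∣ ≡ m → A ∈ subsets n m
∈-subsets A             {zero}  ∣A∣≡0 = here (∣A∣≡0⇒A≡⊥ A ∣A∣≡0)
∈-subsets (outside ∷ A) {suc m} ∣A∣≡m = ∈-++⁺ˡ (∈-map⁺ (outside ∷_) (∈-subsets A ∣A∣≡m))
∈-subsets {suc n} (inside ∷ A) {suc m} ∣A∣≡m = ∈-++⁺ʳ (map (outside ∷_) (subsets n (suc m)))
  (∈-map⁺ (inside ∷_) (∈-subsets A (ℕ.suc-injective ∣A∣≡m)))

subsets-unique : ∀ n m → Unique (subsets n m)
subsets-unique n       zero    = [] ∷ []
subsets-unique zero    (suc m) = []
subsets-unique (suc n) (suc m) = Unique.++⁺
  (Unique.map⁺ (λ { refl → refl }) (subsets-unique n (suc m)))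
  (Unique.map⁺ (λ { refl → refl }) (subsets-unique n m))
  (λ (o , i) → disjoint-images (∈-map⁻ (outside ∷_) o) (∈-map⁻ (inside ∷_) i))
  where
  disjoint-images : ∀ {A : Subset (suc n)} {xs ys : List (Subset n)} →
                    (∃ λ B → B ∈ xs × A ≡ outside ∷ B) → ¬ (∃ λ B → B ∈ ys × A ≡ inside ∷ B)
  disjoint-images (_ , _ , refl) (_ , _ , ())

-- The subset of B whose relative positions inside B are given by A.
embed : (B : Subset n) → Subset ∣ B ∣ → Subset n
embed []            A       = []
embed (outside ∷ B) A       = outside ∷ embed B A
embed (inside  ∷ B) (x ∷ A) = x ∷ embed B A

∣embed∣ : ∀ (B : Subset n) A → ∣ embed B A ∣ ≡ ∣ A ∣
∣embed∣ []            []            = refl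
∣embed∣ (outside ∷ B) A             = ∣embed∣ B A
∣embed∣ (inside  ∷ B) (outside ∷ A) = ∣embed∣ B A
∣embed∣ (inside  ∷ B) (inside  ∷ A) = cong suc (∣embed∣ B A)

embed-⊥ : ∀ (B : Subset n) → embed B ⊥ ≡ ⊥
embed-⊥ []            = refl
embed-⊥ (outside ∷ B) = cong (outside ∷_) (embed-⊥ B)
embed-⊥ (inside  ∷ B) = cong (outside ∷_) (embed-⊥ B)

element-embed : ∀ (B : Subset n) A i →
                element (embed B A) i ≡ element B (element A (Fin.cast (∣embed∣ B A) i))
element-embed (outside ∷ B) A             i       = cong suc (element-embed B A i)
element-embed (inside  ∷ B) (outside ∷ A) i       = cong suc (element-embed B A i)
element-embed (inside  ∷ B) (inside  ∷ A) zero    = refl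
element-embed (inside  ∷ B) (inside  ∷ A) (suc i) = cong suc (element-embed B A i)

-- The order proof is an irrelevant field, so the endpoints determine the edge.
edge-cong : ∀ {i i′ j j′ : Fin n} .{i<j : i Fin.< j} .{i′<j′ : i′ Fin.< j′} →
            i ≡ i′ → j ≡ j′ → edge i j i<j ≡ edge i′ j′ i′<j′
edge-cong refl refl = refl

-- Stated for a free `N`, so that `p` can be matched. In `restrict-embed`, matching `q` fixes `N` as
-- `∣ A ∣`, and `p` becomes an equation between two computed sizes.
restrict≡ : ∀ {N} (D : Subset n) (p : ∣ D ∣ ≡ N) (f : Edge n → X) e {i j} .{i<j : i Fin.< j} →
            element D (Fin.cast (sym p) (src e)) ≡ i → element D (Fin.cast (sym p) (tgt e)) ≡ j →
            restrict D p f e ≡ f (edge i j i<j)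
restrict≡ D refl f e eqᵢ eqⱼ = cong f (edge-cong
  (trans (cong (element D) (sym (Fin.cast-is-id refl (src e)))) eqᵢ)
  (trans (cong (element D) (sym (Fin.cast-is-id refl (tgt e)))) eqⱼ))

restrict-embed : ∀ {N} (B : Subset n) A (p : ∣ embed B A ∣ ≡ N) (q : ∣ A ∣ ≡ N) (f : Edge n → X) e →
                 restrict (embed B A) p f e ≡ restrict A q (restrict B refl f) e
restrict-embed B A p refl f e = restrict≡ (embed B A) p f e (position (src e)) (position (tgt e))
  where
  position : ∀ i → element (embed B A) (Fin.cast (sym p) i) ≡ element B (element A i)
  position i = trans (element-embed B A (Fin.cast (sym p) i))
    (cong (element B ∘ element A) (Fin.cast-involutive (∣embed∣ B A) (sym p) i))

-- The number of m-subsets of an n-set containing a given k-subset.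
above : ℕ → ℕ → ℕ → ℕ
above n       m       zero    = n C m
above zero    m       (suc k) = 0
above (suc n) zero    (suc k) = 0
above (suc n) (suc m) (suc k) = above n m k

above-zero : ∀ n k → above n 0 (suc k) ≡ 0
above-zero zero    k = refl
above-zero (suc n) k = refl

-- For k at most n and m, `above n m k` is (n - k) C (m - k), and this is Pascal's rule for it. At n
-- = m = k the left side would be 0 and the right side 1, hence `k < n`.
above-pascal : ∀ n m k → k < n → above n (suc m) (suc k) ℕ.+ above n m (suc k) ≡ above n m k
above-pascal (suc n) zero    zero    _ = refl
above-pascal (suc n) (suc m) zero    _ = trans (ℕ.+-comm (n C suc m) (n C m)) (nCk+nC[k+1]≡[n+1]C[k+1] n m)
above-pascal (suc n) zero    (suc k) _ = trans (ℕ.+-identityʳ (above n 0 (suc k))) (above-zero n k)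
above-pascal (suc n) (suc m) (suc k) (s≤s k<n) = above-pascal n m k k<n

-- Double counting of pairs A ⊆ B. The induction distinguishes whether the first vertex is outside
-- B, in B but not in A, or in A; the two cases in which it misses A combine by Pascal's rule.
∑∑-subsets : ∀ n m k (g : Subset n → ℚ) →
  ∑ (subsets n m) (λ B → ∑ (subsets ∣ B ∣ k) (g ∘ embed B)) ≡ ι (above n m k) ℚ.* ∑ (subsets n k) g
∑∑-subsets n m zero g = begin
  ∑ (subsets n m) (λ B → g (embed B ⊥) ℚ.+ 0ℚ)  ≡⟨ ∑-cong (subsets n m) (λ B → cong (λ A → g A ℚ.+ 0ℚ) (embed-⊥ B)) ⟩
  ∑ (subsets n m) (λ B → g ⊥ ℚ.+ 0ℚ)            ≡⟨ ∑-const (subsets n m) (g ⊥ ℚ.+ 0ℚ) ⟩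
  ι (length (subsets n m)) ℚ.* (g ⊥ ℚ.+ 0ℚ)     ≡⟨ cong (λ l → ι l ℚ.* (g ⊥ ℚ.+ 0ℚ)) (length-subsets n m) ⟩
  ι (n C m) ℚ.* (g ⊥ ℚ.+ 0ℚ)                    ∎
  where open ≡-Reasoning
∑∑-subsets n zero (suc k) g = begin
  ∑ (subsets ∣ ⊥ {n} ∣ (suc k)) (g ∘ embed ⊥) ℚ.+ 0ℚ
    ≡⟨ cong (λ xs → ∑ xs (g ∘ embed ⊥) ℚ.+ 0ℚ) (subsets-empty (ℕ.≤-trans (s≤s (ℕ.≤-reflexive (∣⊥∣≡0 n))) (s≤s z≤n))) ⟩
  0ℚ
    ≡⟨ sym (ℚ.*-zeroˡ (∑ (subsets n (suc k)) g)) ⟩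
  0ℚ ℚ.* ∑ (subsets n (suc k)) g
    ≡⟨ cong (λ c → ι c ℚ.* ∑ (subsets n (suc k)) g) (sym (above-zero n k)) ⟩
  ι (above n 0 (suc k)) ℚ.* ∑ (subsets n (suc k)) g  ∎
  where open ≡-Reasoning
∑∑-subsets zero (suc m) (suc k) g = refl
∑∑-subsets (suc n) (suc m) (suc k) g = begin
  ∑ (subsets (suc n) (suc m)) (λ B → ∑ (subsets ∣ B ∣ (suc k)) (g ∘ embed B))
    ≡⟨ ∑-subsets-suc n m _ ⟩
  ∑ (subsets n (suc m)) (λ B → ∑ (subsets ∣ B ∣ (suc k)) (gₒ ∘ embed B)) ℚ.+
  ∑ (subsets n m) (λ B → ∑ (subsets (suc ∣ B ∣) (suc k)) (g ∘ embed (inside ∷ B)))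
    ≡⟨ cong₂ ℚ._+_ (∑∑-subsets n (suc m) (suc k) gₒ) inner ⟩
  a ℚ.* Gₒ ℚ.+ (b ℚ.* Gₒ ℚ.+ c ℚ.* Gᵢ)
    ≡⟨ solve 5 (λ a b c x y → a :* x :+ (b :* x :+ c :* y) := (a :+ b) :* x :+ c :* y) refl a b c Gₒ Gᵢ ⟩
  (a ℚ.+ b) ℚ.* Gₒ ℚ.+ c ℚ.* Gᵢ
    ≡⟨ cong (ℚ._+ c ℚ.* Gᵢ) pascal ⟩
  c ℚ.* Gₒ ℚ.+ c ℚ.* Gᵢ
    ≡⟨ sym (ℚ.*-distribˡ-+ c Gₒ Gᵢ) ⟩
  c ℚ.* (Gₒ ℚ.+ Gᵢ)
    ≡⟨ cong (c ℚ.*_) (sym (∑-subsets-suc n k g)) ⟩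
  c ℚ.* ∑ (subsets (suc n) (suc k)) g  ∎
  where
  open ≡-Reasoning
  open ℚ-Solver
  gₒ = g ∘ (outside ∷_)
  gᵢ = g ∘ (inside ∷_)
  Gₒ = ∑ (subsets n (suc k)) gₒ
  Gᵢ = ∑ (subsets n k) gᵢ
  a = ι (above n (suc m) (suc k))
  b = ι (above n m (suc k))
  c = ι (above n m k)
  inner : ∑ (subsets n m) (λ B → ∑ (subsets (suc ∣ B ∣) (suc k)) (g ∘ embed (inside ∷ B))) ≡
          b ℚ.* Gₒ ℚ.+ c ℚ.* Gᵢ
  inner = begin
    ∑ (subsets n m) (λ B → ∑ (subsets (suc ∣ B ∣) (suc k)) (g ∘ embed (inside ∷ B)))
      ≡⟨ ∑-cong (subsets n m) (λ B → ∑-subsets-suc ∣ B ∣ k (g ∘ embed (inside ∷ B))) ⟩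
    ∑ (subsets n m) (λ B → ∑ (subsets ∣ B ∣ (suc k)) (gₒ ∘ embed B) ℚ.+ ∑ (subsets ∣ B ∣ k) (gᵢ ∘ embed B))
      ≡⟨ ∑-+ (subsets n m) _ _ ⟩
    ∑ (subsets n m) (λ B → ∑ (subsets ∣ B ∣ (suc k)) (gₒ ∘ embed B)) ℚ.+
    ∑ (subsets n m) (λ B → ∑ (subsets ∣ B ∣ k) (gᵢ ∘ embed B))
      ≡⟨ cong₂ ℚ._+_ (∑∑-subsets n m (suc k) gₒ) (∑∑-subsets n m k gᵢ) ⟩
    b ℚ.* Gₒ ℚ.+ c ℚ.* Gᵢ ∎
  pascal : (a ℚ.+ b) ℚ.* Gₒ ≡ c ℚ.* Gₒ
  pascal with ℕ.<-≤-connex k n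
  ... | inj₁ k<n = cong (ℚ._* Gₒ)
    (trans (sym (ι-+ (above n (suc m) (suc k)) (above n m (suc k)))) (cong ι (above-pascal n m k k<n)))
  -- Pascal's rule can fail here, but an n-set has no subset of size k + 1, so both sides vanish.
  ... | inj₂ n≤k = trans (cong ((a ℚ.+ b) ℚ.*_) Gₒ≡0)
    (trans (ℚ.*-zeroʳ (a ℚ.+ b)) (sym (trans (cong (c ℚ.*_) Gₒ≡0) (ℚ.*-zeroʳ c))))
    where
    Gₒ≡0 : Gₒ ≡ 0ℚ
    Gₒ≡0 = cong (λ xs → ∑ xs gₒ) (subsets-empty (s≤s n≤k))

-- Double counting for the constant function 1. It eliminates the numbers `above n m k` once
-- averages are compared.
ι-above : ∀ n m k → ι (above n m k) ℚ.* ι (n C k) ≡ ι (n C m) ℚ.* ι (m C k)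
ι-above n m k = begin
  ι (above n m k) ℚ.* ι (n C k)
    ≡⟨ cong (ι (above n m k) ℚ.*_) (sym (count n)) ⟩
  ι (above n m k) ℚ.* ∑ (subsets n k) (λ _ → 1ℚ)
    ≡⟨ sym (∑∑-subsets n m k (λ _ → 1ℚ)) ⟩
  ∑ (subsets n m) (λ B → ∑ (subsets ∣ B ∣ k) (λ _ → 1ℚ))
    ≡⟨ ∑-cong-∈ (subsets n m) (λ B∈ → trans (count _)
         (cong (λ l → ι (l C k)) (All.lookup (subsets-size n m) B∈))) ⟩
  ∑ (subsets n m) (λ _ → ι (m C k))
    ≡⟨ ∑-const (subsets n m) (ι (m C k)) ⟩
  ι (length (subsets n m)) ℚ.* ι (m C k)
    ≡⟨ cong (λ l → ι l ℚ.* ι (m C k)) (length-subsets n m) ⟩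
  ι (n C m) ℚ.* ι (m C k) ∎
  where
  open ≡-Reasoning
  count : ∀ l → ∑ (subsets l k) (λ _ → 1ℚ) ≡ ι (l C k)
  count l = trans (∑-const (subsets l k) 1ℚ)
    (trans (ℚ.*-identityʳ _) (cong ι (length-subsets l k)))

-- The edge sum as a sum over 2-subsets

onSingle : (Fin n → ℚ) → Subset n → ℚ
onSingle v []            = 0ℚ
onSingle v (outside ∷ A) = onSingle (v ∘ suc) A
onSingle v (inside  ∷ A) = v zero

-- The value of `a` at the edge joining the two smallest elements of A, with default 0 when A has
-- fewer than two. Being total on subsets, it brings edge sums under `∑∑-subsets` with k = 2.
onPair : (Edge n → ℚ) → Subset n → ℚ
onPair a []            = 0ℚ
onPair a (outside ∷ A) = onPair (a ∘ sucᵉ) A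
onPair a (inside  ∷ A) = onSingle (λ j → a (edge zero (suc j) ℕ.z<s)) A

onSingle-embed : ∀ v (B : Subset n) A → onSingle v (embed B A) ≡ onSingle (v ∘ element B) A
onSingle-embed v []            []            = refl
onSingle-embed v (outside ∷ B) A             = onSingle-embed (v ∘ suc) B A
onSingle-embed v (inside  ∷ B) (outside ∷ A) = onSingle-embed (v ∘ suc) B A
onSingle-embed v (inside  ∷ B) (inside  ∷ A) = refl

onPair-embed : ∀ a (B : Subset n) A → onPair a (embed B A) ≡ onPair (restrict B refl a) A
onPair-embed a []            []            = refl
onPair-embed a (outside ∷ B) A             = onPair-embed (a ∘ sucᵉ) B A
onPair-embed a (inside  ∷ B) (outside ∷ A) = onPair-embed (a ∘ sucᵉ) B A
onPair-embed a (inside  ∷ B) (inside  ∷ A) = onSingle-embed _ B A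

∑-onSingle : ∀ n (v : Fin n → ℚ) → ∑ (subsets n 1) (onSingle v) ≡ ∑ (allFin n) v
∑-onSingle zero    v = refl
∑-onSingle (suc n) v = begin
  ∑ (subsets (suc n) 1) (onSingle v)                       ≡⟨ ∑-subsets-suc n 0 (onSingle v) ⟩
  ∑ (subsets n 1) (onSingle (v ∘ suc)) ℚ.+ (v zero ℚ.+ 0ℚ)
    ≡⟨ cong₂ ℚ._+_ (∑-onSingle n (v ∘ suc)) (ℚ.+-identityʳ (v zero)) ⟩
  ∑ (allFin n) (v ∘ suc) ℚ.+ v zero                        ≡⟨ ℚ.+-comm _ (v zero) ⟩
  v zero ℚ.+ ∑ (allFin n) (v ∘ suc)                        ≡⟨ cong (v zero ℚ.+_) (sym (∑-map suc (allFin n) v)) ⟩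
  v zero ℚ.+ ∑ (map suc (allFin n)) v                      ≡⟨ cong (λ xs → v zero ℚ.+ ∑ xs v) (List.map-tabulate id suc) ⟩
  ∑ (allFin (suc n)) v                                     ∎
  where open ≡-Reasoning

∑-onPair : ∀ n (a : Edge n → ℚ) → ∑ (subsets n 2) (onPair a) ≡ ∑ (edges n) a
∑-onPair zero    a = refl
∑-onPair (suc n) a = begin
  ∑ (subsets (suc n) 2) (onPair a)
    ≡⟨ ∑-subsets-suc n 1 (onPair a) ⟩
  ∑ (subsets n 2) (onPair (a ∘ sucᵉ)) ℚ.+ ∑ (subsets n 1) (onSingle a₀)
    ≡⟨ cong₂ ℚ._+_ (∑-onPair n (a ∘ sucᵉ)) (∑-onSingle n a₀) ⟩
  ∑ (edges n) (a ∘ sucᵉ) ℚ.+ ∑ (allFin n) a₀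
    ≡⟨ ℚ.+-comm (∑ (edges n) (a ∘ sucᵉ)) (∑ (allFin n) a₀) ⟩
  ∑ (allFin n) a₀ ℚ.+ ∑ (edges n) (a ∘ sucᵉ)
    ≡⟨ sym (∑-map-++-map _ sucᵉ (allFin n) (edges n) a) ⟩
  ∑ (edges (suc n)) a ∎
  where
  open ≡-Reasoning
  a₀ = λ j → a (edge zero (suc j) ℕ.z<s)

length-edges : ∀ n → length (edges n) ≡ n C 2
length-edges zero    = refl
length-edges (suc n) = begin
  length (edges (suc n))
    ≡⟨ List.length-++ (map (λ j → edge zero (suc j) ℕ.z<s) (allFin n)) ⟩
  length (map (λ j → edge {suc n} zero (suc j) ℕ.z<s) (allFin n)) ℕ.+ length (map sucᵉ (edges n))
    ≡⟨ cong₂ ℕ._+_ (trans (List.length-map _ (allFin n)) (List.length-tabulate id)) (List.length-map sucᵉ (edges n)) ⟩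
  n ℕ.+ length (edges n)  ≡⟨ cong (n ℕ.+_) (length-edges n) ⟩
  n ℕ.+ n C 2             ≡⟨ nC2+n≡[n+1]C2 n ⟩
  suc n C 2               ∎
  where open ≡-Reasoning

∑∑-edges : ∀ n m (a : Edge n → ℚ) →
  ∑ (subsets n m) (λ B → ∑ (edges ∣ B ∣) (restrict B refl a)) ≡ ι (above n m 2) ℚ.* ∑ (edges n) a
∑∑-edges n m a = begin
  ∑ (subsets n m) (λ B → ∑ (edges ∣ B ∣) (restrict B refl a))
    ≡⟨ ∑-cong (subsets n m) (λ B → trans (sym (∑-onPair ∣ B ∣ (restrict B refl a)))
         (∑-cong (subsets ∣ B ∣ 2) (λ A → sym (onPair-embed a B A)))) ⟩
  ∑ (subsets n m) (λ B → ∑ (subsets ∣ B ∣ 2) (onPair a ∘ embed B))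
    ≡⟨ ∑∑-subsets n m 2 (onPair a) ⟩
  ι (above n m 2) ℚ.* ∑ (subsets n 2) (onPair a)
    ≡⟨ cong (ι (above n m 2) ℚ.*_) (∑-onPair n a) ⟩
  ι (above n m 2) ℚ.* ∑ (edges n) a ∎
  where open ≡-Reasoning

-- Cuts of sums, products and logarithms

-- Each rational below a sum of reals is below a sum of rationals from the lower cuts. Entropies,
-- which are given by cuts, enter the rational estimates this way.
foldr-L≤ : ∀ (xs : List X) {f : X → ℝ} {b} → (∀ x → U (f x) (b x)) →
           ∀ {q} → L (foldr _+ℝ_ 0ℝ (map f xs)) q → q ℚ.≤ ∑ xs b
foldr-L≤ []       Ub Lq = ℚ.<⇒≤ Lq
foldr-L≤ (x ∷ xs) {f} Ub (_ , _ , Lc , Ld , q<c+d) =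
  ℚ.≤-trans (ℚ.<⇒≤ q<c+d) (ℚ.+-mono-≤ (ℚ.<⇒≤ (L<U (f x) Lc (Ub x))) (foldr-L≤ xs Ub Ld))

foldr-≤U : ∀ (xs : List X) {f : X → ℝ} {a} → (∀ x → L (f x) (a x)) →
           ∀ {q} → U (foldr _+ℝ_ 0ℝ (map f xs)) q → ∑ xs a ℚ.≤ q
foldr-≤U []       La Uq = ℚ.<⇒≤ Uq
foldr-≤U (x ∷ xs) {f} La (_ , _ , Uc , Ud , c+d<q) =
  ℚ.≤-trans (ℚ.+-mono-≤ (ℚ.<⇒≤ (L<U (f x) (La x) Uc)) (foldr-≤U xs La Ud)) (ℚ.<⇒≤ c+d<q)

-- `≤ℝ` speaks of lower cuts only; roundedness of `y` and locatedness of `x` carry it over to upper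
-- cuts.
≤ℝ-U : ∀ x y {q} → x ≤ℝ y → U y q → U x q
≤ℝ-U x y x≤y Uyq with roundedᵘ y Uyq
... | p , p<q , Uyp with located x p<q
...   | inj₁ Lxp = ⊥-elim (disjoint y (x≤y p Lxp) Uyp)
...   | inj₂ Uxq = Uxq

∈ᴮ-fromℚ : ∀ {p} (I : Bracket (fromℚ p)) → p ∈ᴮ I
∈ᴮ-fromℚ I = ℚ.<⇒≤ (lo∈L I) , ℚ.<⇒≤ (hi∈U I)

lo≤hi : ∀ {x} (I : Bracket x) → lo I ℚ.≤ hi I
lo≤hi {x} I = ℚ.<⇒≤ (L<U x (lo∈L I) (hi∈U I))

1/ι*ι≡1 : ∀ j → ℤ.+ 1 ℚ./ suc j ℚ.* ι (suc j) ≡ 1ℚ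
1/ι*ι≡1 j = ℚ.toℚᵘ-injective (ℚᵘ.≃-trans (ℚ.toℚᵘ-homo-* (ℤ.+ 1 ℚ./ suc j) (ι (suc j)))
  (ℚᵘ.≃-trans
    (ℚᵘ.*-cong (ℚ.toℚᵘ-fromℚᵘ (ℚᵘ.mkℚᵘ (ℤ.+ 1) j)) (ℚ.toℚᵘ-fromℚᵘ (ℚᵘ.mkℚᵘ (ℤ.+ suc j) 0)))
    (ℚᵘ.*≡* (trans (ℤ.*-identityʳ _) (cong (ℤ.+_ ∘ suc) (trans (ℕ.+-identityʳ j)
      (sym (trans (ℕ.+-identityʳ _) (ℕ.*-identityʳ j)))))))))

-- The bound on the product holds on a whole box; it is evaluated at the corner formed by the upper
-- end of `I` and the exact value of 1/c. Positivity of `c` excludes the default value of `x ÷ 0`.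
÷-U : ∀ x c {s} → 0 < c → U (x ÷ c) s → ∃ λ v → U x v × v ℚ.≤ s ℚ.* ι c
÷-U x (suc j) {s} _ (r , r<s , I , J , ≤r) = hi I , hi∈U I , (begin
  hi I                    ≡⟨ sym (ℚ.*-identityʳ (hi I)) ⟩
  hi I ℚ.* 1ℚ             ≡⟨ cong (hi I ℚ.*_) (sym (1/ι*ι≡1 j)) ⟩
  hi I ℚ.* (i ℚ.* ι c)    ≡⟨ sym (ℚ.*-assoc (hi I) i (ι c)) ⟩
  hi I ℚ.* i ℚ.* ι c      ≤⟨ *-monoʳ (ι c) (0≤ι c) (≤r (lo≤hi I , ℚ.≤-refl) (∈ᴮ-fromℚ J)) ⟩
  r ℚ.* ι c               ≤⟨ *-monoʳ (ι c) (0≤ι c) (ℚ.<⇒≤ r<s) ⟩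
  s ℚ.* ι c               ∎)
  where
  open ℚ.≤-Reasoning
  c = suc j
  i = ℤ.+ 1 ℚ./ suc j

*fromℕ-U : ∀ x c {q r} → U (x *ℝ fromℕ c) q → L x r → r ℚ.* ι c ℚ.≤ q
*fromℕ-U x c {q} {r} (s , s<q , I , J , ≤s) Lr = begin
  -- `r` may lie to the left of `I`; raised to `r ⊔ lo I` it is still in the lower cut of `x`, hence
  -- inside `I`.
  r ℚ.* ι c              ≤⟨ *-monoʳ (ι c) (0≤ι c) (ℚ.p≤p⊔q r (lo I)) ⟩
  (r ℚ.⊔ lo I) ℚ.* ι c   ≤⟨ ≤s (ℚ.p≤q⊔p r (lo I) , ℚ.<⇒≤ (L<U x (L-⊔ x Lr (lo∈L I)) (hi∈U I))) (∈ᴮ-fromℚ J) ⟩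
  s                      ≤⟨ ℚ.<⇒≤ s<q ⟩
  q                      ∎
  where open ℚ.≤-Reasoning

-- This is where ε < 1 enters: at the corner (p , `lo J`) the second factor is below 1, and p is
-- nonnegative.
fromℚ*-L : ∀ y {p q} → 0ℚ ℚ.≤ p → y <ℝ 1ℝ → L (fromℚ p *ℝ y) q → q ℚ.≤ p
fromℚ*-L y {p} {q} 0≤p (e , Ue , e<1) (r , q<r , I , J , r≤) = begin
  q            ≤⟨ ℚ.<⇒≤ q<r ⟩
  r            ≤⟨ r≤ (∈ᴮ-fromℚ I) (ℚ.≤-refl , lo≤hi J) ⟩
  p ℚ.* lo J   ≤⟨ *-monoˡ p 0≤p (ℚ.<⇒≤ (ℚ.<-trans (L<U y (lo∈L J) Ue) e<1)) ⟩
  p ℚ.* 1ℚ     ≡⟨ ℚ.*-identityʳ p ⟩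
  p            ∎
  where open ℚ.≤-Reasoning

fromℚ**fromℕ-L : ∀ y c {p q} → 0ℚ ℚ.≤ p → y <ℝ 1ℝ → L ((fromℚ p *ℝ y) *ℝ fromℕ c) q → q ℚ.< p ℚ.* ι c
fromℚ**fromℕ-L y c {p} {q} 0≤p y<1 (r , q<r , I , J , r≤) = begin-strict
  q              <⟨ q<r ⟩
  r              ≤⟨ r≤ (ℚ.≤-refl , lo≤hi I) (∈ᴮ-fromℚ J) ⟩
  lo I ℚ.* ι c   ≤⟨ *-monoʳ (ι c) (0≤ι c) (fromℚ*-L y 0≤p y<1 (lo∈L I)) ⟩
  p ℚ.* ι c      ∎
  where open ℚ.≤-Reasoning

-- If k^p < m^d and m ≤ k, then k^p < k^d, so p < d. Hence every edge weight is at most 1.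
log-L⇒≤1 : ∀ {k m} → 1 < k → m ≤ k → ∀ q → log-L k m q → q ℚ.≤ 1ℚ
log-L⇒≤1 {k} {m} 1<k m≤k (mkℚ (ℤ.+ p) d c) k^p<m^d = ℚ.*≤* (subst₂ ℤ._≤_
  (sym (ℤ.*-identityʳ (ℤ.+ p))) (sym (ℤ.*-identityˡ (ℤ.+ suc d))) (ℤ.+≤+ (ℕ.<⇒≤ p<d)))
  where
  p<d : p < suc d
  p<d = ℕ.≰⇒> λ d≤p → ℕ.<⇒≱ k^p<m^d
    (ℕ.≤-trans (ℕ.^-monoˡ-≤ (suc d) m≤k) (ℕ.^-monoʳ-≤ k {{ℕ.>-nonZero (ℕ.<-trans ℕ.z<s 1<k)}} d≤p))
log-L⇒≤1 _ _ (mkℚ ℤ.-[1+ _ ] _ _) _ = ℚ.*≤* ℤ.-≤+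

-- Copies of forbidden colourings in templates

restrict-≼ : ∀ {k N} {c : Colouring k n} {t : Template k n} (A : Subset n) (∣A∣≡N : ∣ A ∣ ≡ N) →
             c ≼ t → restrict A ∣A∣≡N c ≼ restrict A ∣A∣≡N t
restrict-≼ A refl c≼t e = c≼t _

all-edges? : ∀ {P : Edge n → Set} → Decidable P → Dec (∀ e → P e)
all-edges? {n} {P} P? = map′ uncurryᵉ (λ h i j i<j → h (edge i j i<j))
  (Fin.all? λ i → Fin.all? λ j → at i j)
  where
  uncurryᵉ : (∀ i j → .(i<j : i Fin.< j) → P (edge i j i<j)) → ∀ e → P e
  uncurryᵉ h (edge i j i<j) = h i j i<j
  at : ∀ i j → Dec (.(i<j : i Fin.< j) → P (edge i j i<j))
  at i j with i Fin.<? j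
  ... | yes i<j = map′ (λ p _ → p) (λ h → h i<j) (P? (edge i j i<j))
  -- A pair out of order carries no edge; its order proof is irrelevant, so the absurdity must be
  -- eliminated irrelevantly.
  ... | no  i≮j = yes λ i<j → ⊥-elim-irr (i≮j i<j)

module Copies {k} .{{_ : NonTrivial k}} {N m} (F : Fin m → Colouring k N) where

  -- The index is existential, so each set is counted once however many colourings of `F` fit there.
  -- This count is a lower bound for the number of pairs.
  Copy : Template k n → Subset n → Set
  Copy t A = Σ (∣ A ∣ ≡ N) λ ∣A∣≡N → ∃ λ i → F i ≼ restrict A ∣A∣≡N t

  copy? : (t : Template k n) → Decidable (Copy t)
  copy? t A with ∣ A ∣ ℕ.≟ N
  ... | no  ∣A∣≢N = no (∣A∣≢N ∘ proj₁)
  ... | yes ∣A∣≡N = map′ (∣A∣≡N ,_)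
    (λ (eq , i , h) → i , subst (λ eq → F i ≼ restrict A eq t) (ℕ.≡-irrelevant eq ∣A∣≡N) h)
    (Fin.any? λ i → all-edges? λ e → F i e ∈? proj₁ (restrict A ∣A∣≡N t e))

  copy-embed : (t : Template k n) (B : Subset n) {A : Subset ∣ B ∣} →
               Copy (restrict B refl t) A → Copy t (embed B A)
  copy-embed t B {A} (∣A∣≡N , i , h) = ∣BA∣≡N , i ,
    λ e → subst (λ S → F i e ∈ₛ proj₁ S) (sym (restrict-embed B A ∣BA∣≡N ∣A∣≡N t e)) (h e)
    where ∣BA∣≡N = trans (∣embed∣ B A) ∣A∣≡N

  -- If a realisation of `t` induced a forbidden colouring on A, that colouring would be a
  -- realisation of `t` restricted to A, hence a copy.
  copy-free⇒admissible : (t : Template k n) → (∀ A → ¬ Copy t A) → Admissible (Forb F) t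
  copy-free⇒admissible t free c c≼t A ∣A∣≡N i c≗Fi = free A (∣A∣≡N , i ,
    λ e → subst (_∈ₛ proj₁ (restrict A ∣A∣≡N t e)) (c≗Fi e) (restrict-≼ {c = c} {t} A ∣A∣≡N c≼t e))

  copies : Template k n → List (Subset n)
  copies {n} t = filter (copy? t) (subsets n N)

  module _ (t : Template k n) (a : Edge n → ℚ) (M : ℕ) {v w : ℚ} (0≤w : 0ℚ ℚ.≤ w)
           (a≤w : ∀ e → a e ℚ.≤ w)
           (sparse : ∀ B → ∣ B ∣ ≡ M → (∀ A → ¬ Copy (restrict B refl t) A) →
                     ∑ (edges ∣ B ∣) (restrict B refl a) ℚ.≤ v) where

    private
      -- Chosen so that `v + K` is at least the trivial bound (M C 2) w, with K nonnegative whatever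
      -- the sign of `v`.
      K : ℚ
      K = ℚ.∣ v ∣ ℚ.+ ι (M C 2) ℚ.* w

      0≤Ew : 0ℚ ℚ.≤ ι (M C 2) ℚ.* w
      0≤Ew = *-nonNeg (0≤ι (M C 2)) 0≤w

      0≤K : 0ℚ ℚ.≤ K
      0≤K = ℚ.+-mono-≤ {0ℚ} {ℚ.∣ v ∣} {0ℚ} {ι (M C 2) ℚ.* w} (ℚ.0≤∣p∣ v) 0≤Ew

      hits : Subset n → ℚ
      hits B = ∑ (subsets ∣ B ∣ N) (𝟙 ∘ copy? t ∘ embed B)

      -- One linear bound for both kinds of M-set: a copy-free one obeys `v`, and elsewhere a single
      -- hit already lifts `v` to the trivial bound.
      edge-sum≤hits : ∀ B → ∣ B ∣ ≡ M → ∑ (edges ∣ B ∣) (restrict B refl a) ℚ.≤ v ℚ.+ K ℚ.* hits B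
      edge-sum≤hits B ∣B∣≡M with none-or-1≤∑𝟙 (copy? t ∘ embed B) (subsets ∣ B ∣ N)
      ... | inj₁ none = ℚ.≤-trans
        (sparse B ∣B∣≡M λ A copy → All.lookup none (∈-subsets A (proj₁ copy)) (copy-embed t B copy))
        (p≤p+q v (*-nonNeg {K} 0≤K (0≤∑𝟙 (copy? t ∘ embed B) (subsets ∣ B ∣ N))))
      ... | inj₂ 1≤hits = begin
        ∑ (edges ∣ B ∣) (restrict B refl a)  ≤⟨ ∑-mono (edges ∣ B ∣) (λ _ → a≤w _) ⟩
        ∑ (edges ∣ B ∣) (λ _ → w)            ≡⟨ ∑-const (edges ∣ B ∣) w ⟩
        ι (length (edges ∣ B ∣)) ℚ.* w
          ≡⟨ cong (λ l → ι l ℚ.* w) (trans (length-edges ∣ B ∣) (cong (_C 2) ∣B∣≡M)) ⟩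
        ι (M C 2) ℚ.* w                      ≡⟨ solve 2 (λ v e → e := v :+ (:- v :+ e)) refl v (ι (M C 2) ℚ.* w) ⟩
        v ℚ.+ (ℚ.- v ℚ.+ ι (M C 2) ℚ.* w)    ≤⟨ ℚ.+-monoʳ-≤ v (ℚ.+-monoˡ-≤ (ι (M C 2) ℚ.* w) (-p≤∣p∣ v)) ⟩
        v ℚ.+ K                              ≡⟨ cong (v ℚ.+_) (sym (ℚ.*-identityʳ K)) ⟩
        v ℚ.+ K ℚ.* 1ℚ                       ≤⟨ ℚ.+-monoʳ-≤ v (*-monoˡ K 0≤K 1≤hits) ⟩
        v ℚ.+ K ℚ.* hits B                   ∎
        where
        open ℚ.≤-Reasoning
        open ℚ-Solver

    -- The previous bound summed over all M-sets. Both sides are double counts: of edges on the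
    -- left, of copies on the right.
    average-bound : ι (above n M 2) ℚ.* ∑ (edges n) a ℚ.≤
               ι (n C M) ℚ.* v ℚ.+ K ℚ.* (ι (above n M N) ℚ.* ι (length (copies t)))
    average-bound = begin
      ι (above n M 2) ℚ.* ∑ (edges n) a
        ≡⟨ sym (∑∑-edges n M a) ⟩
      ∑ (subsets n M) (λ B → ∑ (edges ∣ B ∣) (restrict B refl a))
        ≤⟨ ∑-mono (subsets n M) (λ {B} B∈ → edge-sum≤hits B (All.lookup (subsets-size n M) B∈)) ⟩
      ∑ (subsets n M) (λ B → v ℚ.+ K ℚ.* hits B)
        ≡⟨ ∑-+ (subsets n M) (λ _ → v) (λ B → K ℚ.* hits B) ⟩
      ∑ (subsets n M) (λ _ → v) ℚ.+ ∑ (subsets n M) (λ B → K ℚ.* hits B)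
        ≡⟨ cong₂ ℚ._+_ (∑-const (subsets n M) v) (∑-*ˡ (subsets n M) K hits) ⟩
      ι (length (subsets n M)) ℚ.* v ℚ.+ K ℚ.* ∑ (subsets n M) hits
        ≡⟨ cong₂ (λ l h → ι l ℚ.* v ℚ.+ K ℚ.* h) (length-subsets n M) (∑∑-subsets n M N (𝟙 ∘ copy? t)) ⟩
      ι (n C M) ℚ.* v ℚ.+ K ℚ.* (ι (above n M N) ℚ.* ∑ (subsets n N) (𝟙 ∘ copy? t))
        ≡⟨ cong (λ h → ι (n C M) ℚ.* v ℚ.+ K ℚ.* (ι (above n M N) ℚ.* h)) (∑𝟙≡length-filter (copy? t) (subsets n N)) ⟩
      ι (n C M) ℚ.* v ℚ.+ K ℚ.* (ι (above n M N) ℚ.* ι (length (copies t))) ∎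
      where open ℚ.≤-Reasoning

-- To be read with T = n C M, E = M C 2, A = n C 2, P = n C N, Q = M C N, with c and d the
-- numbers of M-sets containing a given pair and a given N-set, and H the number of copies.
average-bound⇒density-bound : ∀ T E A P Q c d S H r s K →
          0ℚ ℚ.< T → 0ℚ ℚ.≤ P → 0ℚ ℚ.≤ c →
          c ℚ.* S ℚ.≤ T ℚ.* (s ℚ.* E) ℚ.+ K ℚ.* (d ℚ.* H) →
          r ℚ.* A ℚ.≤ S → c ℚ.* A ≡ T ℚ.* E → d ℚ.* P ≡ T ℚ.* Q →
          (r ℚ.- s) ℚ.* E ℚ.* P ℚ.≤ K ℚ.* Q ℚ.* H
average-bound⇒density-bound T E A P Q c d S H r s K 0<T 0≤P 0≤c cS≤ rA≤S cA≡TE dP≡TQ =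
  ℚ.*-cancelˡ-≤-pos T {{ℚ.positive 0<T}} (begin
    T ℚ.* ((r ℚ.- s) ℚ.* E ℚ.* P)
      ≡⟨ solve 5 (λ T r s E P → T :* ((r :- s) :* E :* P) := (r :* (T :* E) :- T :* (s :* E)) :* P) refl T r s E P ⟩
    (r ℚ.* (T ℚ.* E) ℚ.- V) ℚ.* P
      ≡⟨ cong (λ x → (r ℚ.* x ℚ.- V) ℚ.* P) (sym cA≡TE) ⟩
    (r ℚ.* (c ℚ.* A) ℚ.- V) ℚ.* P
      ≡⟨ cong (λ x → (x ℚ.- V) ℚ.* P) (solve 3 (λ r c A → r :* (c :* A) := c :* (r :* A)) refl r c A) ⟩
    (c ℚ.* (r ℚ.* A) ℚ.- V) ℚ.* P
      ≤⟨ *-monoʳ P 0≤P (ℚ.+-monoˡ-≤ (ℚ.- V) (ℚ.≤-trans (*-monoˡ c 0≤c rA≤S) cS≤)) ⟩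
    (V ℚ.+ K ℚ.* (d ℚ.* H) ℚ.- V) ℚ.* P
      ≡⟨ solve 5 (λ V K d H P → (V :+ K :* (d :* H) :- V) :* P := K :* (d :* P) :* H) refl V K d H P ⟩
    K ℚ.* (d ℚ.* P) ℚ.* H
      ≡⟨ cong (λ x → K ℚ.* x ℚ.* H) dP≡TQ ⟩
    K ℚ.* (T ℚ.* Q) ℚ.* H
      ≡⟨ solve 4 (λ K T Q H → K :* (T :* Q) :* H := T :* (K :* Q :* H)) refl K T Q H ⟩
    T ℚ.* (K ℚ.* Q ℚ.* H) ∎)
  where
  open ℚ.≤-Reasoning
  open ℚ-Solver
  V = T ℚ.* (s ℚ.* E)

-- γ = g / (D + 1) is fixed before `P` and `H`, which makes it uniform in n.
density-constant : ∀ {g D} → 0ℚ ℚ.< g → 0ℚ ℚ.≤ D →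
        ∃ λ γ → 0ℚ ℚ.< γ × (∀ P H → 0ℚ ℚ.≤ H → g ℚ.* P ℚ.≤ D ℚ.* H → γ ℚ.* P ℚ.≤ H)
density-constant {g} {D} 0<g 0≤D = let γ , γD′≡g = divide g D′ 0<D′ in γ , pos {γ} γD′≡g , bound {γ} γD′≡g
  where
  open ℚ.≤-Reasoning
  open ℚ-Solver
  -- D vanishes in the application when M < N.
  D′ = D ℚ.+ 1ℚ
  0<D′ : 0ℚ ℚ.< D′
  0<D′ = ℚ.≤-<-trans {0ℚ} {D} {D′} 0≤D (p<p+e D {1ℚ} 0<1)
  pos : ∀ {γ} → γ ℚ.* D′ ≡ g → 0ℚ ℚ.< γ
  pos {γ} γD′≡g = ℚ.*-cancelʳ-<-nonNeg D′ {{ℚ.nonNegative (ℚ.<⇒≤ 0<D′)}} {0ℚ} {γ}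
    (subst₂ ℚ._<_ (sym (ℚ.*-zeroˡ D′)) (sym γD′≡g) 0<g)
  bound : ∀ {γ} → γ ℚ.* D′ ≡ g → ∀ P H → 0ℚ ℚ.≤ H → g ℚ.* P ℚ.≤ D ℚ.* H → γ ℚ.* P ℚ.≤ H
  bound {γ} γD′≡g P H 0≤H gP≤DH = ℚ.*-cancelˡ-≤-pos D′ {{ℚ.positive 0<D′}} (begin
    D′ ℚ.* (γ ℚ.* P)  ≡⟨ solve 3 (λ D γ P → D :* (γ :* P) := γ :* D :* P) refl D′ γ P ⟩
    γ ℚ.* D′ ℚ.* P    ≡⟨ cong (ℚ._* P) γD′≡g ⟩
    g ℚ.* P           ≤⟨ gP≤DH ⟩
    D ℚ.* H           ≤⟨ p≤p+q (D ℚ.* H) 0≤H ⟩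
    D ℚ.* H ℚ.+ H     ≡⟨ solve 2 (λ D H → D :* H :+ H := (D :+ con 1ℚ) :* H) refl D H ⟩
    D′ ℚ.* H          ∎)

room : ∀ {p q} → p ℚ.< q → ∃ λ η → 0ℚ ℚ.< η × p ℚ.+ η ℚ.< q
room {p} {q} p<q = let m , p<m , m<q = ℚ.<-dense p<q in
  m ℚ.- p , p<q⇒0<q-p p<m , subst (ℚ._< q) (sym (p+[q-p] p m)) m<q

-- Rational approximation of the entropy

module Approximation {k} .{{_ : NonTrivial k}} {n} (t : Template k n) {η} (0<η : 0ℚ ℚ.< η) where

  -- Repeats the summand local to `Ent`, so that `Ent t` unfolds to the sum of these weights.
  weight : Edge n → ℝ
  weight e = log k ∣ proj₁ (t e) ∣ {{m≢0 = nonempty⇒nonZero (proj₂ (t e))}}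

  narrow : ∀ e → Σ (Bracket (weight e)) λ I → _ × _ × hi I ℚ.< lo I ℚ.+ η
  narrow e = refine (some (weight e)) η 0<η

  lower upper : Edge n → ℚ
  lower e = lo (proj₁ (narrow e))
  upper e = hi (proj₁ (narrow e))

  upper≤lower+η : ∀ e → upper e ℚ.≤ lower e ℚ.+ η
  upper≤lower+η e = ℚ.<⇒≤ (proj₂ (proj₂ (proj₂ (narrow e))))

  upper≤1+η : ∀ e → upper e ℚ.≤ 1ℚ ℚ.+ η
  upper≤1+η e = ℚ.≤-trans (upper≤lower+η e) (ℚ.+-monoˡ-≤ η
    (log-L⇒≤1 {k} (ℕ.nonTrivial⇒n>1 k) (∣p∣≤n (proj₁ (t e))) (lower e) (lo∈L (proj₁ (narrow e)))))

  L-Ent : ∀ {q} → L (Ent t) q → q ℚ.≤ ∑ (edges n) upper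
  L-Ent = foldr-L≤ (edges n) (λ e → hi∈U (proj₁ (narrow e)))

  -- All restrictions reuse the brackets of `t`, since the averaging needs a single edge function.
  -- An upper cut controls only the lower ends, and passing to the upper ends costs η per edge.
  U-Ent-restrict : ∀ B {q} → U (Ent (restrict B refl t)) q →
                   ∑ (edges ∣ B ∣) (restrict B refl upper) ℚ.≤ q ℚ.+ ι (∣ B ∣ C 2) ℚ.* η
  U-Ent-restrict B {q} Uq = begin
    ∑ (edges ∣ B ∣) (restrict B refl upper)
      ≤⟨ ∑-mono (edges ∣ B ∣) (λ _ → upper≤lower+η _) ⟩
    ∑ (edges ∣ B ∣) (λ e → restrict B refl lower e ℚ.+ η)
      ≡⟨ ∑-+ (edges ∣ B ∣) (restrict B refl lower) (λ _ → η) ⟩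
    ∑ (edges ∣ B ∣) (restrict B refl lower) ℚ.+ ∑ (edges ∣ B ∣) (λ _ → η)
      ≤⟨ ℚ.+-monoˡ-≤ _ (foldr-≤U (edges ∣ B ∣) (λ _ → lo∈L (proj₁ (narrow _))) Uq) ⟩
    q ℚ.+ ∑ (edges ∣ B ∣) (λ _ → η)
      ≡⟨ cong (q ℚ.+_) (trans (∑-const (edges ∣ B ∣) η) (cong (λ l → ι l ℚ.* η) (length-edges ∣ B ∣))) ⟩
    q ℚ.+ ι (∣ B ∣ C 2) ℚ.* η ∎
    where open ℚ.≤-Reasoning

-- Supersaturation and the theorem

module _ {k} .{{_ : NonTrivial k}} {N m} (F : Fin m → Colouring k N) where
  open Copies F

  -- One index is chosen for each set that carries a copy; the pairs are distinct because their
  -- first components are.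
  copy-pairs : (t : Template k n) → ∃ λ (pairs : List (Subset n × Fin m)) →
           Unique pairs ×
           All (λ (A , i) → Σ (∣ A ∣ ≡ N) λ ∣A∣≡N → F i ≼ restrict A ∣A∣≡N t) pairs ×
           length pairs ≡ length (copies t)
  copy-pairs {n} t = All.reduce pick all , Unique.map⁻ (subst Unique (sym (map-pick all)) unique) , valid all ,
    trans (sym (List.length-map proj₁ (All.reduce pick all))) (cong length (map-pick all))
    where
    pick : ∀ {A} → Copy t A → Subset n × Fin m
    pick {A} (_ , i , _) = A , i

    all : All (Copy t) (copies t)
    all = All.all-filter (copy? t) (subsets n N)

    unique : Unique (copies t)
    unique = Unique.filter⁺ (copy? t) (subsets-unique n N)

    map-pick : ∀ {xs} (ps : All (Copy t) xs) → map proj₁ (All.reduce pick ps) ≡ xs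
    map-pick []       = refl
    map-pick (_ ∷ ps) = cong (_ ∷_) (map-pick ps)

    valid : ∀ {xs} (ps : All (Copy t) xs) →
            All (λ (A , i) → Σ (∣ A ∣ ≡ N) λ ∣A∣≡N → F i ≼ restrict A ∣A∣≡N t) (All.reduce pick ps)
    valid []                  = []
    valid ((eq , _ , h) ∷ ps) = (eq , h) ∷ valid ps

  module _ {M x y s r v η} (isEx : IsEx (Forb F) M x) (2≤M : 2 ≤ M)
           (Uv : U x v) (v≤ : v ℚ.≤ s ℚ.* ι (M C 2))
           (Lr : L y r) (0<η : 0ℚ ℚ.< η) (s+η<r : s ℚ.+ η ℚ.< r) where

    private
      E = ι (M C 2)
      -- Agrees by definition with the constant of the averaging bound at v = (s + η) E and w = 1 +
      -- η.
      K = ℚ.∣ (s ℚ.+ η) ℚ.* E ∣ ℚ.+ E ℚ.* (1ℚ ℚ.+ η)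

      0<1+η : 0ℚ ℚ.< 1ℚ ℚ.+ η
      0<1+η = ℚ.<-trans {0ℚ} {1ℚ} {1ℚ ℚ.+ η} 0<1 (p<p+e 1ℚ {η} 0<η)

      0≤K : 0ℚ ℚ.≤ K
      0≤K = ℚ.+-mono-≤ {0ℚ} {ℚ.∣ (s ℚ.+ η) ℚ.* E ∣} {0ℚ} {E ℚ.* (1ℚ ℚ.+ η)}
        (ℚ.0≤∣p∣ _) (*-nonNeg (0≤ι (M C 2)) (ℚ.<⇒≤ 0<1+η))

      sparse : (t : Template k n) → let open Approximation t 0<η in
               ∀ B → ∣ B ∣ ≡ M → (∀ A → ¬ Copy (restrict B refl t) A) →
               ∑ (edges ∣ B ∣) (restrict B refl upper) ℚ.≤ (s ℚ.+ η) ℚ.* E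
      sparse t B refl free = begin
        ∑ (edges ∣ B ∣) (restrict B refl upper)
          ≤⟨ U-Ent-restrict B (≤ℝ-U (Ent (restrict B refl t)) x
               (IsEx.upperBound isEx (restrict B refl t) (copy-free⇒admissible (restrict B refl t) free)) Uv) ⟩
        v ℚ.+ E ℚ.* η          ≤⟨ ℚ.+-monoˡ-≤ (E ℚ.* η) v≤ ⟩
        s ℚ.* E ℚ.+ E ℚ.* η    ≡⟨ solve 3 (λ s E η → s :* E :+ E :* η := (s :+ η) :* E) refl s E η ⟩
        (s ℚ.+ η) ℚ.* E        ∎
        where
        open Approximation t 0<η
        open ℚ.≤-Reasoning
        open ℚ-Solver

    supersaturation-from-bounds : ∃ λ γ → 0ℚ ℚ.< γ × (∀ n → M ≤ n → (t : Template k n) →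
                       y *ℝ fromℕ (n C 2) <ℝ Ent t → γ ℚ.* ι (n C N) ℚ.≤ ι (length (copies t)))
    supersaturation-from-bounds = let γ , 0<γ , γ-bound = density-constant {g} {K ℚ.* ι (M C N)} 0<g 0≤KQ in
      γ , 0<γ , λ n M≤n t (q , Uq , Lq) → let open Approximation t 0<η in
        γ-bound (ι (n C N)) (ι (length (copies t))) (0≤ι (length (copies t)))
          (average-bound⇒density-bound (ι (n C M)) E (ι (n C 2)) (ι (n C N)) (ι (M C N))
            (ι (above n M 2)) (ι (above n M N)) (∑ (edges n) upper) (ι (length (copies t))) r (s ℚ.+ η) K
            (0<ι (0<nCk M≤n)) (0≤ι (n C N)) (0≤ι (above n M 2))
            (average-bound t upper M (ℚ.<⇒≤ 0<1+η) upper≤1+η (sparse t))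
            (ℚ.≤-trans (*fromℕ-U y (n C 2) Uq Lr) (L-Ent Lq)) (ι-above n M 2) (ι-above n M N))
      where
      -- The gap between the density r below that of `t` and the density s + η allowed to copy-free
      -- M-sets, scaled by E.
      g = (r ℚ.- (s ℚ.+ η)) ℚ.* E
      0<g : 0ℚ ℚ.< g
      0<g = *-pos {r ℚ.- (s ℚ.+ η)} {E} (p<q⇒0<q-p s+η<r) (0<ι (0<nCk 2≤M))
      0≤KQ : 0ℚ ℚ.≤ K ℚ.* ι (M C N)
      0≤KQ = *-nonNeg 0≤K (0≤ι (M C N))

  supersaturation : ∀ {M x y} → IsEx (Forb F) M x → 2 ≤ M → x ÷ (M C 2) <ℝ y →
    ∃ λ γ → 0ℚ ℚ.< γ × (∀ n → M ≤ n → (t : Template k n) →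
    y *ℝ fromℕ (n C 2) <ℝ Ent t → γ ℚ.* ι (n C N) ℚ.≤ ι (length (copies t)))
  supersaturation {M} {x} {y} isEx 2≤M (s , Us , Ls) =
    -- `s` separates x / (M C 2) from `y`; `r` is taken above `s` but still below `y`, and η fits
    -- between them to absorb the approximation error.
    let v , Uv , v≤    = ÷-U x (M C 2) (0<nCk 2≤M) Us
        r , s<r , Lr   = roundedˡ y Ls
        η , 0<η , s+η<r = room s<r
    in supersaturation-from-bounds {M} {x} {y} {s} {r} {v} {η} isEx 2≤M Uv v≤ Lr 0<η s+η<r

lemma2p11 : (k : ℕ) .{{_ : NonTrivial k}} (N m : ℕ) .{{_ : NonZero m}}
    (F : Fin m → Colouring k N) → Injective _≡_ _≗_ F →
    (∀ n → ∃ (Forb F n)) →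
    (π : ℝ) → IsEntropyDensity (Forb F) π →
    (ε : ℝ) → 0ℝ <ℝ ε → ε <ℝ 1ℝ →
    ∃ λ (n₀ : ℕ) → Σ ℝ λ C₀ → 0ℝ <ℝ C₀ ×
    (∀ n → n₀ ≤ n → (t : Template k n) →
    (π +ℝ ε) *ℝ fromℕ (n C 2) <ℝ Ent t →
    ∃ λ (pairs : List (Subset n × Fin m)) →
    Unique pairs ×
    All (λ (A , i) → Σ (∣ A ∣ ≡ N) λ ∣A∣≡N → F i ≼ restrict A ∣A∣≡N t) pairs ×
    (C₀ *ℝ ε) *ℝ fromℕ (n C N) ≤ℝ fromℕ (length pairs))
lemma2p11 k N m F _ _ π (ex , isEx , ex⟶π) ε 0<ε ε<1 =
  -- The tolerance is ε itself, which gives ex(M) / (M C 2) < π + ε; adding 2 to the threshold makes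
  -- M C 2 positive.
  let n₁ , close-to-π = ex⟶π ε 0<ε
      M = 2 ℕ.+ n₁
      γ , 0<γ , γ-bound = supersaturation F {M} {ex M} {π +ℝ ε} (isEx M) (ℕ.m≤m+n 2 n₁)
                            (proj₁ (close-to-π M (ℕ.m≤n+m n₁ 2)))
  in M , fromℚ γ , ℚ.<-dense 0<γ , λ n M≤n t Ent> →
     let pairs , unique , valid , length≡ = copy-pairs F t in
     -- `≤ℝ` compares lower cuts: a rational below γ ε (n C N) is below γ (n C N), hence below the
     -- number of pairs.
     pairs , unique , valid , λ q Lq → ℚ.<-≤-trans (fromℚ**fromℕ-L ε (n C N) (ℚ.<⇒≤ 0<γ) ε<1 Lq)
       (subst (λ l → γ ℚ.* ι (n C N) ℚ.≤ ι l) (sym length≡) (γ-bound n M≤n t Ent>))
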